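{- Let $p,q$ be coprime positive integers. The sequence $\{S_m(p,q)\}_{m\ge0}$ is periodic of period $pq$, and over one full period its mean is given by $$\frac{1}{pq}\sum_{m=0}^{pq-1}S_m(p,q)=0.$$ In particular, the moments oscillate symmetrically around $0$. Moreover, the variance is given by $$\frac{1}{pq}\sum_{m=0}^{pq-1}|S_m(p,q)|^2=(p-1)(q-1).$$
   Context: For coprime positive integers $p,q$ and an integer $m$, the $m$-th moment is $S_m(p,q)=\sum_{\zeta\in\mathcal{Z}_{p,q}}\zeta^m$, where $\mathcal{Z}_{p,q}=\{\zeta\in\mathbb{C}:\zeta^{pq}=1,\ \zeta^p\ne1,\ \zeta^q\ne1\}$ is the set of zeros of the Alexander polynomial $\frac{(t^{pq}-1)(t-1)}{(t^p-1)(t^q-1)}$ of the torus knot $T_{p,q}$. "Periodic of period $pq$" means $S_{m+pq}(p,q)=S_m(p,q)$ for all $m$. -}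

module Defs where

open import Algebra.Bundles using (CommutativeRing; RawRing)
open import Algebra.Structures using (IsCommutativeRing)
import Algebra.Definitions.RawSemiring as RawSemiringDefs
import Algebra.Properties.Ring as RingProperties
import Algebra.Solver.Ring.NaturalCoefficients.Default as SemiringSolver
open import Data.Empty using (⊥-elim)
open import Data.Fin.Base using (Fin)
open import Data.Integer.Base using (ℤ; +_; -[1+_])
open import Data.Nat.Base using (ℕ; suc)
import Data.Nat.Base as ℕ
open import Data.Product.Base using (∃; _×_; _,_; proj₁; proj₂)
open import Data.Sum.Base using (inj₁; inj₂)
open import Level using (_⊔_; Lift; lift)
import Level as L
open import Relation.Binary.Core using (Rel)
open import Relation.Binary.Bundles using (StrictTotalOrder)
open import Relation.Binary.Definitions using (tri<; tri≈; tri>)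
open import Relation.Binary.Structures using (IsStrictTotalOrder)
import Relation.Binary.Construct.StrictToNonStrict as ToNonStrict
import Relation.Binary.Reasoning.StrictPartialOrder as OrderReasoning
open import Relation.Binary.PropositionalEquality.Core using (_≡_)
open import Relation.Nullary.Negation.Core using (¬_)
open import Relation.Unary using (Pred)

-- The standard library has no real numbers.  ℝ is taken to be an arbitrary
-- Dedekind-complete ordered field (classically, there is exactly one up to
-- isomorphism).  Decidability of _≈_ and _<_ is part of the order structure.
-- Constructively the record is an assumption, not something one can inhabit.

record CompleteOrderedField c ℓ₁ ℓ₂ : Set (L.suc (c ⊔ ℓ₁ ⊔ ℓ₂)) where
  infix  4 _≈_ _<_
  infixl 7 _*_
  infixl 6 _+_
  infix  8 -_
  infix  9 _⁻¹
  field
    Carrier            : Set c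
    _≈_                : Rel Carrier ℓ₁
    _<_                : Rel Carrier ℓ₂
    _+_ _*_            : Carrier → Carrier → Carrier
    -_                 : Carrier → Carrier
    0# 1#              : Carrier
    -- The value of 0# ⁻¹ is unspecified.
    _⁻¹                : Carrier → Carrier
    isCommutativeRing  : IsCommutativeRing _≈_ _+_ _*_ -_ 0# 1#
    isStrictTotalOrder : IsStrictTotalOrder _≈_ _<_
    *-inverseʳ         : ∀ {x} → ¬ (x ≈ 0#) → x * x ⁻¹ ≈ 1#
    0<1                : 0# < 1#
    +-monoˡ-<          : ∀ z {x y} → x < y → x + z < y + z
    *-pos              : ∀ {x y} → 0# < x → 0# < y → 0# < x * y

  open ToNonStrict _≈_ _<_ public using (_≤_)

  UpperBound : Pred Carrier (c ⊔ ℓ₁ ⊔ ℓ₂) → Pred Carrier (c ⊔ ℓ₁ ⊔ ℓ₂)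
  UpperBound P u = ∀ x → P x → x ≤ u

  LeastUpperBound : Pred Carrier (c ⊔ ℓ₁ ⊔ ℓ₂) → Pred Carrier (c ⊔ ℓ₁ ⊔ ℓ₂)
  LeastUpperBound P s = UpperBound P s × (∀ u → UpperBound P u → s ≤ u)

  field
    supremum : ∀ (P : Pred Carrier (c ⊔ ℓ₁ ⊔ ℓ₂)) →
               ∃ P → ∃ (UpperBound P) → ∃ (LeastUpperBound P)

  commutativeRing : CommutativeRing c ℓ₁
  commutativeRing = record { isCommutativeRing = isCommutativeRing }

  strictTotalOrder : StrictTotalOrder c ℓ₁ ℓ₂
  strictTotalOrder = record { isStrictTotalOrder = isStrictTotalOrder }

module RealProperties {c ℓ₁ ℓ₂} (ℝ : CompleteOrderedField c ℓ₁ ℓ₂) where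

  open CompleteOrderedField ℝ public
  open CommutativeRing commutativeRing public
    using ( _-_; rawRing; ring; semiring; commutativeSemiring; setoid
          ; refl; sym; trans
          ; +-cong; +-congˡ; +-congʳ; +-comm; +-assoc; +-identityˡ; +-identityʳ
          ; *-cong; *-congˡ; *-congʳ; *-comm; *-assoc; *-identityˡ; *-identityʳ
          ; distribˡ; distribʳ; zeroˡ; zeroʳ; -‿cong; -‿inverseˡ; -‿inverseʳ )
  open StrictTotalOrder strictTotalOrder public
    using (compare; irrefl; strictPartialOrder; <-resp-≈)
    renaming (trans to <-trans)
  open RawSemiringDefs (RawRing.rawSemiring rawRing) public
    using (_^_) renaming (_×_ to _·ℕ_; sum to ∑)
  open RingProperties ring using (-‿distribˡ-*; -‿distribʳ-*; -‿involutive)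

  fromℕ : ℕ → Carrier
  fromℕ n = n ·ℕ 1#

  private
    module R = OrderReasoning strictPartialOrder
    open SemiringSolver commutativeSemiring using (solve; _:+_; _:*_; _:=_)

    ≤-trans : ∀ {x y z} → x ≤ y → y ≤ z → x ≤ z
    ≤-trans {x} {y} {z} p q = R.begin x R.≤⟨ p ⟩ y R.≤⟨ q ⟩ z R.∎

    <⇒≱ : ∀ {x y} → x < y → ¬ (y ≤ x)
    <⇒≱ {x} {y} p q = irrefl refl x<x
      where
      x<x : x < x
      x<x = R.begin-strict x R.<⟨ p ⟩ y R.≤⟨ q ⟩ x R.∎

    ≮⇒≥ : ∀ {x y} → ¬ (x < y) → y ≤ x
    ≮⇒≥ {x} {y} x≮y with compare x y
    ... | tri< x<y _ _ = ⊥-elim (x≮y x<y)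
    ... | tri≈ _ x≈y _ = inj₂ (sym x≈y)
    ... | tri> _ _ y<x = inj₁ y<x

    +-monoʳ-< : ∀ z {x y} → x < y → z + x < z + y
    +-monoʳ-< z {x} {y} x<y = R.begin-strict
      z + x  R.≈⟨ +-comm z x ⟩
      x + z  R.<⟨ +-monoˡ-< z x<y ⟩
      y + z  R.≈⟨ +-comm y z ⟩
      z + y  R.∎

    +-monoʳ-≤ : ∀ z {x y} → x ≤ y → z + x ≤ z + y
    +-monoʳ-≤ z (inj₁ x<y) = inj₁ (+-monoʳ-< z x<y)
    +-monoʳ-≤ z (inj₂ x≈y) = inj₂ (+-congˡ x≈y)

    +-monoˡ-≤ : ∀ z {x y} → x ≤ y → x + z ≤ y + z
    +-monoˡ-≤ z (inj₁ x<y) = inj₁ (+-monoˡ-< z x<y)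
    +-monoˡ-≤ z (inj₂ x≈y) = inj₂ (+-congʳ x≈y)

    +-cancelʳ-≤ : ∀ z {x y} → x + z ≤ y + z → x ≤ y
    +-cancelʳ-≤ z p = ≮⇒≥ (λ y<x → <⇒≱ (+-monoˡ-< z y<x) p)

    x<x+y : ∀ x {y} → 0# < y → x < x + y
    x<x+y x {y} 0<y = R.begin-strict
      x       R.≈⟨ sym (+-identityʳ x) ⟩
      x + 0#  R.<⟨ +-monoʳ-< x 0<y ⟩
      x + y   R.∎

    x≤x+y : ∀ x {y} → 0# ≤ y → x ≤ x + y
    x≤x+y x {y} 0≤y = R.begin
      x       R.≈⟨ sym (+-identityʳ x) ⟩
      x + 0#  R.≤⟨ +-monoʳ-≤ x 0≤y ⟩
      x + y   R.∎

    -- x < y is witnessed by a positive difference.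
    difference : ∀ {x y} → x < y → ∃ λ d → 0# < d × x + d ≈ y
    difference {x} {y} x<y = y - x , 0<y-x , x+[y-x]≈y
      where
      0<y-x : 0# < y - x
      0<y-x = R.begin-strict
        0#     R.≈⟨ sym (-‿inverseʳ x) ⟩
        x - x  R.<⟨ +-monoˡ-< (- x) x<y ⟩
        y - x  R.∎
      x+[y-x]≈y : x + (y - x) ≈ y
      x+[y-x]≈y = R.begin-equality
        x + (y - x)    R.≈⟨ +-comm x (y - x) ⟩
        (y - x) + x    R.≈⟨ +-assoc y (- x) x ⟩
        y + (- x + x)  R.≈⟨ +-congˡ (-‿inverseˡ x) ⟩
        y + 0#         R.≈⟨ +-identityʳ y ⟩
        y              R.∎

    *-nonneg : ∀ {x y} → 0# ≤ x → 0# ≤ y → 0# ≤ x * y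
    *-nonneg (inj₁ p) (inj₁ q) = inj₁ (*-pos p q)
    *-nonneg {x} {y} (inj₂ p) _ = inj₂ (trans (sym (zeroˡ y)) (*-congʳ p))
    *-nonneg {x} {y} (inj₁ _) (inj₂ q) = inj₂ (trans (sym (zeroʳ x)) (*-congˡ q))

    *-monoʳ-< : ∀ {z x y} → 0# < z → x < y → z * x < z * y
    *-monoʳ-< {z} {x} {y} 0<z x<y with difference x<y
    ... | d , 0<d , x+d≈y = R.begin-strict
      z * x          R.<⟨ x<x+y (z * x) (*-pos 0<z 0<d) ⟩
      z * x + z * d  R.≈⟨ sym (distribˡ z x d) ⟩
      z * (x + d)    R.≈⟨ *-congˡ x+d≈y ⟩
      z * y          R.∎

    *-monoʳ-≤ : ∀ {z x y} → 0# ≤ z → x ≤ y → z * x ≤ z * y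
    *-monoʳ-≤ (inj₁ p) (inj₁ q) = inj₁ (*-monoʳ-< p q)
    *-monoʳ-≤ {z} {x} {y} (inj₂ p) _ =
      inj₂ (trans (trans (*-congʳ (sym p)) (zeroˡ x))
                  (trans (sym (zeroˡ y)) (*-congʳ p)))
    *-monoʳ-≤ (inj₁ _) (inj₂ q) = inj₂ (*-congˡ q)

    square-mono-< : ∀ {x y} → 0# ≤ x → x < y → x * x < y * y
    square-mono-< {x} {y} 0≤x x<y = R.begin-strict
      x * x  R.≤⟨ *-monoʳ-≤ 0≤x (inj₁ x<y) ⟩
      x * y  R.≈⟨ *-comm x y ⟩
      y * x  R.<⟨ *-monoʳ-< 0<y x<y ⟩
      y * y  R.∎
      where
      0<y : 0# < y
      0<y = R.begin-strict 0# R.≤⟨ 0≤x ⟩ x R.<⟨ x<y ⟩ y R.∎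

    pos⇒≉0 : ∀ {x} → 0# < x → ¬ (x ≈ 0#)
    pos⇒≉0 0<x x≈0 = irrefl (sym x≈0) 0<x

    -- d / k for positive d and k.
    quotient : ∀ {d k} → 0# < d → 0# < k → ∃ λ ε → 0# < ε × k * ε ≈ d
    quotient {d} {k} 0<d 0<k = ε , 0<ε , kε≈d
      where
      ε = d * k ⁻¹
      kε≈d : k * ε ≈ d
      kε≈d = R.begin-equality
        k * (d * k ⁻¹)  R.≈⟨ solve 3 (λ a b e → a :* (b :* e) := b :* (a :* e)) refl k d (k ⁻¹) ⟩
        d * (k * k ⁻¹)  R.≈⟨ *-congˡ (*-inverseʳ (pos⇒≉0 0<k)) ⟩
        d * 1#          R.≈⟨ *-identityʳ d ⟩
        d               R.∎
      ε≤0⇒d≤0 : ε ≤ 0# → d ≤ 0#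
      ε≤0⇒d≤0 ε≤0 = R.begin
        d       R.≈⟨ sym kε≈d ⟩
        k * ε   R.≤⟨ *-monoʳ-≤ (inj₁ 0<k) ε≤0 ⟩
        k * 0#  R.≈⟨ zeroʳ k ⟩
        0#      R.∎
      0<ε : 0# < ε
      0<ε with compare 0# ε
      ... | tri< p _ _ = p
      ... | tri≈ _ p _ = ⊥-elim (<⇒≱ 0<d (ε≤0⇒d≤0 (inj₂ (sym p))))
      ... | tri> _ _ p = ⊥-elim (<⇒≱ 0<d (ε≤0⇒d≤0 (inj₁ p)))

  square-nonneg : ∀ x → 0# ≤ x * x
  square-nonneg x with compare 0# x
  ... | tri< 0<x _ _ = inj₁ (*-pos 0<x 0<x)
  ... | tri≈ _ 0≈x _ = inj₂ (trans (sym (zeroˡ x)) (*-congʳ 0≈x))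
  ... | tri> _ _ x<0 = R.begin
    0#           R.≤⟨ *-nonneg (inj₁ 0<-x) (inj₁ 0<-x) ⟩
    - x * - x    R.≈⟨ sym (-‿distribˡ-* x (- x)) ⟩
    - (x * - x)  R.≈⟨ -‿cong (sym (-‿distribʳ-* x x)) ⟩
    - - (x * x)  R.≈⟨ -‿involutive (x * x) ⟩
    x * x        R.∎
    where
    0<-x : 0# < - x
    0<-x = R.begin-strict
      0#      R.≈⟨ sym (-‿inverseʳ x) ⟩
      x - x   R.<⟨ +-monoˡ-< (- x) x<0 ⟩
      0# - x  R.≈⟨ +-identityˡ (- x) ⟩
      - x     R.∎

  +-nonneg : ∀ {x y} → 0# ≤ x → 0# ≤ y → 0# ≤ x + y
  +-nonneg {x} {y} 0≤x 0≤y = ≤-trans 0≤x (x≤x+y x 0≤y)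

  private
    square-increase : ∀ {s a} → 0# ≤ s → s * s < a → ∃ λ t → s < t × t * t ≤ a
    square-increase {s} {a} 0≤s s²<a with difference s²<a
    ... | d , 0<d , s²+d≈a = step (quotient 0<d 0<k+d)
      where
      k : Carrier
      k = (s + s) + 1#
      0<k : 0# < k
      0<k = R.begin-strict
        0#     R.≤⟨ +-nonneg 0≤s 0≤s ⟩
        s + s  R.<⟨ x<x+y (s + s) 0<1 ⟩
        k      R.∎
      0<k+d : 0# < k + d
      0<k+d = <-trans 0<k (x<x+y k 0<d)
      step : (∃ λ ε → 0# < ε × (k + d) * ε ≈ d) → ∃ λ t → s < t × t * t ≤ a
      step (ε , 0<ε , [k+d]ε≈d) = s + ε , x<x+y s 0<ε , [s+ε]²≤a
        where
        kε≤d : k * ε ≤ d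
        kε≤d = R.begin
          k * ε          R.≤⟨ x≤x+y (k * ε) (inj₁ (*-pos 0<d 0<ε)) ⟩
          k * ε + d * ε  R.≈⟨ sym (distribʳ ε k d) ⟩
          (k + d) * ε    R.≈⟨ [k+d]ε≈d ⟩
          d              R.∎
        ε≤1 : ε ≤ 1#
        ε≤1 = ≮⇒≥ λ 1<ε → <⇒≱ (x<x+y d 0<k) (inj₁ (R.begin-strict
          d + k         R.≈⟨ trans (+-comm d k) (sym (*-identityʳ (k + d))) ⟩
          (k + d) * 1#  R.<⟨ *-monoʳ-< 0<k+d 1<ε ⟩
          (k + d) * ε   R.≈⟨ [k+d]ε≈d ⟩
          d             R.∎))
        [s+ε]²≤a : (s + ε) * (s + ε) ≤ a
        [s+ε]²≤a = R.begin
          (s + ε) * (s + ε)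
            R.≈⟨ solve 2 (λ s e → (s :+ e) :* (s :+ e)
                           := s :* s :+ ((s :+ s) :* e :+ e :* e)) refl s ε ⟩
          s * s + ((s + s) * ε + ε * ε)
            R.≤⟨ +-monoʳ-≤ (s * s) (+-monoʳ-≤ ((s + s) * ε) (*-monoʳ-≤ (inj₁ 0<ε) ε≤1)) ⟩
          s * s + ((s + s) * ε + ε * 1#)
            R.≈⟨ +-congˡ (trans (+-congˡ (*-comm ε 1#)) (sym (distribʳ ε (s + s) 1#))) ⟩
          s * s + k * ε
            R.≤⟨ +-monoʳ-≤ (s * s) kε≤d ⟩
          s * s + d
            R.≈⟨ s²+d≈a ⟩
          a R.∎

    square-decrease : ∀ {s a} → 0# ≤ s → 0# ≤ a → a < s * s →
                      ∃ λ t → 0# < t × t < s × a ≤ t * t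
    square-decrease {s} {a} 0≤s 0≤a a<s² with difference a<s²
    ... | d , 0<d , a+d≈s² = step (quotient 0<d 0<s+s)
      where
      0<s² : 0# < s * s
      0<s² = R.begin-strict 0# R.≤⟨ 0≤a ⟩ a R.<⟨ a<s² ⟩ s * s R.∎
      0<s : 0# < s
      0<s with compare 0# s
      ... | tri< p _ _ = p
      ... | tri≈ _ 0≈s _ = ⊥-elim (irrefl (trans (sym (zeroˡ s)) (*-congʳ 0≈s)) 0<s²)
      ... | tri> _ _ s<0 = ⊥-elim (<⇒≱ s<0 0≤s)
      0<s+s : 0# < s + s
      0<s+s = <-trans 0<s (x<x+y s 0<s)
      d≤s² : d ≤ s * s
      d≤s² = R.begin
        d      R.≤⟨ x≤x+y d 0≤a ⟩
        d + a  R.≈⟨ trans (+-comm d a) a+d≈s² ⟩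
        s * s  R.∎
      step : (∃ λ ε → 0# < ε × (s + s) * ε ≈ d) → ∃ λ t → 0# < t × t < s × a ≤ t * t
      step (ε , 0<ε , 2sε≈d) = step′ (difference ε<s)
        where
        s≰ε : ¬ (s ≤ ε)
        s≰ε s≤ε = <⇒≱ (x<x+y (s * s) 0<s²) (R.begin
          s * s + s * s  R.≈⟨ sym (distribʳ s s s) ⟩
          (s + s) * s    R.≤⟨ *-monoʳ-≤ (inj₁ 0<s+s) s≤ε ⟩
          (s + s) * ε    R.≈⟨ 2sε≈d ⟩
          d              R.≤⟨ d≤s² ⟩
          s * s          R.∎)
        ε<s : ε < s
        ε<s with compare ε s
        ... | tri< p _ _ = p
        ... | tri≈ _ p _ = ⊥-elim (s≰ε (inj₂ (sym p)))
        ... | tri> _ _ p = ⊥-elim (s≰ε (inj₁ p))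
        step′ : (∃ λ t → 0# < t × ε + t ≈ s) → ∃ λ t → 0# < t × t < s × a ≤ t * t
        step′ (t , 0<t , ε+t≈s) = t , 0<t , t<s , a≤t²
          where
          t<s : t < s
          t<s = R.begin-strict
            t      R.<⟨ x<x+y t 0<ε ⟩
            t + ε  R.≈⟨ trans (+-comm t ε) ε+t≈s ⟩
            s      R.∎
          a≤t² : a ≤ t * t
          a≤t² = +-cancelʳ-≤ d (R.begin
            a + d
              R.≈⟨ a+d≈s² ⟩
            s * s
              R.≈⟨ *-cong (sym ε+t≈s) (sym ε+t≈s) ⟩
            (ε + t) * (ε + t)
              R.≈⟨ solve 2 (λ e t → (e :+ t) :* (e :+ t)
                             := t :* t :+ e :* ((e :+ t) :+ t)) refl ε t ⟩
            t * t + ε * ((ε + t) + t)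
              R.≈⟨ +-congˡ (*-congˡ (+-congʳ ε+t≈s)) ⟩
            t * t + ε * (s + t)
              R.≤⟨ +-monoʳ-≤ (t * t) (*-monoʳ-≤ (inj₁ 0<ε) (+-monoʳ-≤ s (inj₁ t<s))) ⟩
            t * t + ε * (s + s)
              R.≈⟨ +-congˡ (trans (*-comm ε (s + s)) 2sε≈d) ⟩
            t * t + d R.∎)

    Below : Carrier → Pred Carrier (c ⊔ ℓ₁ ⊔ ℓ₂)
    Below a r = Lift (c ⊔ ℓ₁ ⊔ ℓ₂) (r * r ≤ a)

    square-bound : ∀ {a t} → 0# ≤ t → a ≤ t * t → UpperBound (Below a) t
    square-bound 0≤t a≤t² r (lift r²≤a) =
      ≮⇒≥ (λ t<r → <⇒≱ (square-mono-< 0≤t t<r) (≤-trans r²≤a a≤t²))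

    sqrt-bound : ∀ {a} → 0# ≤ a → UpperBound (Below a) (a + 1#)
    sqrt-bound {a} 0≤a = square-bound 0≤a+1 (R.begin
      a                       R.≤⟨ x≤x+y a (+-nonneg 0≤a+1 (square-nonneg a)) ⟩
      a + ((a + 1#) + a * a)  R.≈⟨ solve 2 (λ a e → a :+ ((a :+ e) :+ a :* a)
                                                 := a :* a :+ a :+ a :+ e) refl a 1# ⟩
      a * a + a + a + 1#
        R.≈⟨ +-cong (+-cong (+-congˡ (sym (*-identityʳ a))) (sym (*-identityʳ a)))
                    (sym (*-identityʳ 1#)) ⟩
      a * a + a * 1# + a * 1# + 1# * 1#
        R.≈⟨ solve 2 (λ a e → a :* a :+ a :* e :+ a :* e :+ e :* e
                       := (a :+ e) :* (a :+ e)) refl a 1# ⟩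
      (a + 1#) * (a + 1#)     R.∎)
      where
      0≤a+1 : 0# ≤ a + 1#
      0≤a+1 = +-nonneg 0≤a (inj₁ 0<1)

    lub⇒sqrt : ∀ {a s} → 0# ≤ a → LeastUpperBound (Below a) s → 0# ≤ s × s * s ≈ a
    lub⇒sqrt {a} {s} 0≤a (upper , least) = 0≤s , s²≈a
      where
      0≤s : 0# ≤ s
      0≤s = upper 0# (lift (≤-trans (inj₂ (zeroˡ 0#)) 0≤a))
      s²≮a : ¬ (s * s < a)
      s²≮a p = let t , s<t , t²≤a = square-increase 0≤s p in
        <⇒≱ s<t (upper t (lift t²≤a))
      s²≯a : ¬ (a < s * s)
      s²≯a p = let t , 0<t , t<s , a≤t² = square-decrease 0≤s 0≤a p in
        <⇒≱ t<s (least t (square-bound (inj₁ 0<t) a≤t²))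
      s²≈a : s * s ≈ a
      s²≈a with compare (s * s) a
      ... | tri< p _ _ = ⊥-elim (s²≮a p)
      ... | tri≈ _ p _ = p
      ... | tri> _ _ p = ⊥-elim (s²≯a p)

  abstract
    sqrt : ∀ {a} → 0# ≤ a → ∃ λ r → 0# ≤ r × r * r ≈ a
    sqrt {a} 0≤a = proj₁ lub , lub⇒sqrt 0≤a (proj₂ lub)
      where
      lub : ∃ (LeastUpperBound (Below a))
      lub = supremum (Below a) (0# , lift (≤-trans (inj₂ (zeroˡ 0#)) 0≤a))
                               (a + 1# , sqrt-bound 0≤a)

module Complex {c ℓ₁ ℓ₂} (ℝ : CompleteOrderedField c ℓ₁ ℓ₂) where

  private module ℝ = RealProperties ℝ

  infix 4 _≈_
  infixl 6 _+_
  infixl 7 _*_ _·_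
  infix  8 -_
  infix  9 _⁻¹
  infixr 8 _^ᶻ_

  record ℂ : Set c where
    constructor _+i_
    field
      re im : ℝ.Carrier

  open ℂ public

  record _≈_ (z w : ℂ) : Set ℓ₁ where
    constructor _,_
    field
      re-≈ : re z ℝ.≈ re w
      im-≈ : im z ℝ.≈ im w

  open _≈_ public

  _+_ _*_ : ℂ → ℂ → ℂ
  z + w = (re z ℝ.+ re w) +i (im z ℝ.+ im w)
  z * w = (re z ℝ.* re w ℝ.- im z ℝ.* im w) +i (re z ℝ.* im w ℝ.+ im z ℝ.* re w)

  -_ : ℂ → ℂ
  - z = (ℝ.- re z) +i (ℝ.- im z)

  0# 1# : ℂ
  0# = ℝ.0# +i ℝ.0#
  1# = ℝ.1# +i ℝ.0#

  _·_ : ℝ.Carrier → ℂ → ℂ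
  r · z = (r ℝ.* re z) +i (r ℝ.* im z)

  rawRing : RawRing c ℓ₁
  rawRing = record
    { _≈_ = _≈_ ; _+_ = _+_ ; _*_ = _*_ ; -_ = -_ ; 0# = 0# ; 1# = 1# }

  open RawSemiringDefs (RawRing.rawSemiring rawRing) public
    using (_^_) renaming (sum to ∑)

  ∣_∣ : ℂ → ℝ.Carrier
  ∣ z ∣ = proj₁ (ℝ.sqrt (ℝ.+-nonneg (ℝ.square-nonneg (re z)) (ℝ.square-nonneg (im z))))

  -- The conjugate of z divided by |z|²; unspecified at 0#.
  _⁻¹ : ℂ → ℂ
  z ⁻¹ = (re z ℝ.* re z ℝ.+ im z ℝ.* im z) ℝ.⁻¹ · (re z +i (ℝ.- im z))

  _^ᶻ_ : ℂ → ℤ → ℂ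
  z ^ᶻ (+ n)    = z ^ n
  z ^ᶻ -[1+ n ] = (z ⁻¹) ^ suc n

  𝒵 : ℕ → ℕ → Pred ℂ ℓ₁
  𝒵 p q ζ = ζ ^ (p ℕ.* q) ≈ 1# × ¬ (ζ ^ p ≈ 1#) × ¬ (ζ ^ q ≈ 1#)

  record Finite {ℓ} (P : Pred ℂ ℓ) : Set (c ⊔ ℓ₁ ⊔ ℓ) where
    field
      size      : ℕ
      enum      : Fin size → ℂ
      injective : ∀ {i j} → enum i ≈ enum j → i ≡ j
      sound     : ∀ i → P (enum i)
      complete  : ∀ {z} → P z → ∃ λ i → enum i ≈ z

  -- By commutativity of addition the sum does not depend, up to _≈_, on the
  -- enumeration chosen.
  moment : ∀ p q → Finite (𝒵 p q) → ℤ → ℂ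
  moment p q fin m = ∑ (λ i → Finite.enum fin i ^ᶻ m)

{-# OPTIONS --safe #-}
module Submission where

-- The moments are power sums over 𝒵, so mean and variance follow by exchanging
-- sums: a root of unity w ≠ 1 of order dividing N has ∑_{m<N} w^m = 0, and
-- ζ ζ̄′ = 1 for ζ, ζ′ ∈ 𝒵 only if ζ = ζ′, so the variance is the size of 𝒵.
-- By the Chinese remainder theorem 𝒵 is (μ_p ∖ 1) × (μ_q ∖ 1), of size
-- (p - 1)(q - 1), provided that ℂ contains primitive n-th roots of unity.  These
-- are found without trigonometry: the largest root r of the Chebyshev polynomial
-- U_{n-1} plays the role of cos (π / n).  The supremum property gives r, and the
-- lower U_k are positive at r, so (r + i √(1 - r²))^k is not real for 0 < k < n,
-- while its n-th power is -1; its square is primitive.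

open import Defs
open import Algebra.Bundles using (CommutativeMonoid; CommutativeRing; RawRing)
import Algebra.Properties.CommutativeSemigroup as CommutativeSemigroupProperties
import Algebra.Properties.CommutativeSemiring.Exp as Exp
import Algebra.Properties.Ring as RingProperties
import Algebra.Properties.Semiring.Mult as Mult
import Algebra.Properties.Semiring.Sum as Sum
import Algebra.Solver.Ring
open import Algebra.Solver.Ring.AlmostCommutativeRing
  using (fromCommutativeRing; _-Raw-AlmostCommutative⟶_)
open import Data.Empty using (⊥-elim)
open import Data.Fin.Base using (Fin; toℕ)
import Data.Fin.Base as Fin
import Data.Fin.Properties as Fin
open import Data.Integer.Base using (ℤ; +_; -[1+_])
import Data.Integer.Base as ℤ
import Data.Integer.Properties as ℤ
open import Data.Maybe.Base using (Maybe; just; nothing)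
open import Data.Nat.Base as ℕ using (ℕ; zero; suc; NonZero; z≤n; s≤s)
open import Data.Nat.Coprimality using (Coprime; coprime-Bézout)
open import Data.Nat.Divisibility using (_∣_; divides; *-monoˡ-∣)
open import Data.Nat.DivMod using (_%_; _/_; m≡m%n+[m/n]*n; m%n<n)
open import Data.Nat.GCD using (module Bézout)
import Data.Nat.Properties as ℕ
open import Data.Nat.Tactic.RingSolver using (solve-∀)
open import Data.Product.Base using (_×_; _,_; proj₁; proj₂; ∃; ∃₂)
open import Data.Sum.Base using (inj₁; inj₂)
open import Data.Vec.Functional using (removeAt)
open import Function.Base using (_∘_; _⟨_⟩_)
open import Level as L using (Lift; lift; _⊔_)
open import Relation.Binary.Definitions using (Decidable; tri<; tri≈; tri>)
import Relation.Binary.PropositionalEquality as ≡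
open ≡ using (_≡_; _≢_)
import Relation.Binary.Reasoning.Setoid as SetoidReasoning
import Relation.Binary.Reasoning.StrictPartialOrder as OrderReasoning
open import Relation.Nullary.Decidable.Core using (yes; no)
open import Relation.Nullary.Negation.Core using (¬_)

-- The theorem quantifies over every enumeration of `𝒵 p q`, and the variance first comes out as the
-- length of that enumeration, so the closed form needs an exact count. The lower bound relies on
-- completeness: in a field with too few roots of unity the set would be smaller. The upper bound,
-- that the n-th roots of unity are only the powers of a primitive one, avoids counting roots of
-- polynomials; one double sum is evaluated in two orders, and decidable equality picks out the
-- exponent. A supremum is a zero only of a function that is under quantitative control. Continuity
-- is therefore replaced by a one-sided Lipschitz estimate on [0, 1], read off the divided
-- differences of the Chebyshev polynomials, which satisfy a recurrence of their own.

-- Integer coefficients are formal differences m - n of natural numbers, reduced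
-- by _⊖_ to a canonical form.  The separate 𝟘 and 𝟙 are there so that the
-- constants of the solver denote 0# and 1# on the nose.
data Difference : Set where
  𝟘 𝟙 : Difference
  diff : (m n : ℕ) → Difference

_⊖_ : ℕ → ℕ → Difference
suc m ⊖ suc n = m ⊖ n
0     ⊖ 0     = 𝟘
1     ⊖ 0     = 𝟙
m     ⊖ n     = diff m n

-- A ring solver with integer coefficients over any commutative ring.

module DifferenceSolver {c ℓ} (A : CommutativeRing c ℓ) where

  open CommutativeRing A
  open Mult semiring using (×1-homo-*; ×-homo-+; ×-congˡ) renaming (_×_ to _·ℕ_)
  open CommutativeSemigroupProperties (CommutativeMonoid.commutativeSemigroup +-commutativeMonoid)
    using (interchange)
  open SetoidReasoning setoid

  private
    module P = RingProperties ring
    fromℕ : ℕ → Carrier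
    fromℕ n = n ·ℕ 1#

    plus minus : Difference → ℕ
    plus 𝟘 = 0
    plus 𝟙 = 1
    plus (diff m n) = m
    minus 𝟘 = 0
    minus 𝟙 = 0
    minus (diff m n) = n

    rawDifference : RawRing _ _
    rawDifference = record
      { Carrier = Difference
      ; _≈_ = _≡_
      ; _+_ = λ x y → (plus x ℕ.+ plus y) ⊖ (minus x ℕ.+ minus y)
      ; _*_ = λ x y → (plus x ℕ.* plus y ℕ.+ minus x ℕ.* minus y)
                         ⊖ (plus x ℕ.* minus y ℕ.+ minus x ℕ.* plus y)
      ; -_ = λ x → minus x ⊖ plus x
      ; 0# = 𝟘
      ; 1# = 𝟙
      }

    ⟦_⟧ : Difference → Carrier
    ⟦ 𝟘 ⟧ = 0#
    ⟦ 𝟙 ⟧ = 1#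
    ⟦ diff m n ⟧ = fromℕ m - fromℕ n

    ⟦⟧-diff : ∀ x → ⟦ x ⟧ ≈ fromℕ (plus x) - fromℕ (minus x)
    ⟦⟧-diff 𝟘 = sym (-‿inverseʳ 0#)
    ⟦⟧-diff 𝟙 = sym (begin
      (1# + 0#) - 0#  ≈⟨ +-assoc 1# 0# (- 0#) ⟩
      1# + (0# - 0#)  ≈⟨ +-congˡ (-‿inverseʳ 0#) ⟩
      1# + 0#         ≈⟨ +-identityʳ 1# ⟩
      1#              ∎)
    ⟦⟧-diff (diff m n) = refl

    ⟦⊖⟧ : ∀ m n → ⟦ m ⊖ n ⟧ ≈ fromℕ m - fromℕ n
    ⟦⊖⟧ (suc m) (suc n) = begin
      ⟦ m ⊖ n ⟧                            ≈⟨ ⟦⊖⟧ m n ⟩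
      fromℕ m - fromℕ n                    ≈⟨ +-identityˡ _ ⟨
      0# + (fromℕ m - fromℕ n)             ≈⟨ +-congʳ (-‿inverseʳ 1#) ⟨
      (1# - 1#) + (fromℕ m - fromℕ n)      ≈⟨ interchange _ _ _ _ ⟩
      (1# + fromℕ m) + (- 1# - fromℕ n)    ≈⟨ +-congˡ (P.-‿+-comm _ _) ⟩
      fromℕ (suc m) - fromℕ (suc n)        ∎
    ⟦⊖⟧ zero          zero    = ⟦⟧-diff 𝟘
    ⟦⊖⟧ (suc zero)    zero    = ⟦⟧-diff 𝟙
    ⟦⊖⟧ (suc (suc m)) zero    = refl
    ⟦⊖⟧ zero          (suc n) = refl

    +-homo : ∀ x y → ⟦ (plus x ℕ.+ plus y) ⊖ (minus x ℕ.+ minus y) ⟧ ≈ ⟦ x ⟧ + ⟦ y ⟧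
    +-homo x y = trans (⟦⊖⟧ (plus x ℕ.+ plus y) (minus x ℕ.+ minus y)) (begin
      fromℕ (plus x ℕ.+ plus y) - fromℕ (minus x ℕ.+ minus y)
        ≈⟨ +-cong (×-homo-+ 1# (plus x) (plus y))
             (trans (-‿cong (×-homo-+ 1# (minus x) (minus y))) (sym (P.-‿+-comm _ _))) ⟩
      (fromℕ (plus x) + fromℕ (plus y)) + (- fromℕ (minus x) - fromℕ (minus y))
        ≈⟨ interchange _ _ _ _ ⟩
      (fromℕ (plus x) - fromℕ (minus x)) + (fromℕ (plus y) - fromℕ (minus y))
        ≈⟨ +-cong (⟦⟧-diff x) (⟦⟧-diff y) ⟨
      ⟦ x ⟧ + ⟦ y ⟧ ∎)

    fromℕ-dot : ∀ a b c d → fromℕ (a ℕ.* b ℕ.+ c ℕ.* d) ≈ fromℕ a * fromℕ b + fromℕ c * fromℕ d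
    fromℕ-dot a b c d = trans (×-homo-+ 1# (a ℕ.* b) (c ℕ.* d)) (+-cong (×1-homo-* a b) (×1-homo-* c d))

    *-diff : ∀ a b c d → (a - b) * (c - d) ≈ (a * c + b * d) - (a * d + b * c)
    *-diff a b c d = begin
      (a - b) * (c - d)                    ≈⟨ distribʳ (c - d) a (- b) ⟩
      a * (c - d) + (- b) * (c - d)        ≈⟨ +-cong (distribˡ a c (- d)) (distribˡ (- b) c (- d)) ⟩
      (a * c + a * - d) + (- b * c + - b * - d)
        ≈⟨ +-cong (+-congˡ (sym (P.-‿distribʳ-* a d)))
             (trans (+-comm _ _) (+-cong
               (trans (sym (P.-‿distribˡ-* b (- d)))
                 (trans (-‿cong (sym (P.-‿distribʳ-* b d))) (P.-‿involutive (b * d))))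
               (sym (P.-‿distribˡ-* b c)))) ⟩
      (a * c - a * d) + (b * d - b * c)    ≈⟨ interchange _ _ _ _ ⟩
      (a * c + b * d) + (- (a * d) - b * c) ≈⟨ +-congˡ (P.-‿+-comm _ _) ⟩
      (a * c + b * d) - (a * d + b * c)    ∎

    homomorphism : rawDifference -Raw-AlmostCommutative⟶ fromCommutativeRing A
    homomorphism = record
      { ⟦_⟧    = ⟦_⟧
      ; +-homo = +-homo
      ; *-homo = λ x y → trans (⟦⊖⟧ (plus x ℕ.* plus y ℕ.+ minus x ℕ.* minus y) _) (begin
          fromℕ (plus x ℕ.* plus y ℕ.+ minus x ℕ.* minus y)
            - fromℕ (plus x ℕ.* minus y ℕ.+ minus x ℕ.* plus y)
            ≈⟨ +-cong (fromℕ-dot (plus x) (plus y) (minus x) (minus y))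
                      (-‿cong (fromℕ-dot (plus x) (minus y) (minus x) (plus y))) ⟩
          (fromℕ (plus x) * fromℕ (plus y) + fromℕ (minus x) * fromℕ (minus y))
            - (fromℕ (plus x) * fromℕ (minus y) + fromℕ (minus x) * fromℕ (plus y))
            ≈⟨ *-diff _ _ _ _ ⟨
          (fromℕ (plus x) - fromℕ (minus x)) * (fromℕ (plus y) - fromℕ (minus y))
            ≈⟨ *-cong (⟦⟧-diff x) (⟦⟧-diff y) ⟨
          ⟦ x ⟧ * ⟦ y ⟧ ∎)
      ; -‿homo = λ x → trans (⟦⊖⟧ (minus x) (plus x)) (begin
          fromℕ (minus x) - fromℕ (plus x)         ≈⟨ +-comm _ _ ⟩
          - fromℕ (plus x) + fromℕ (minus x)       ≈⟨ +-congˡ (P.-‿involutive _) ⟨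
          - fromℕ (plus x) - - fromℕ (minus x)     ≈⟨ P.-‿+-comm _ _ ⟩
          - (fromℕ (plus x) - fromℕ (minus x))     ≈⟨ -‿cong (⟦⟧-diff x) ⟨
          - ⟦ x ⟧ ∎)
      ; 0-homo = refl
      ; 1-homo = refl
      }

    -- Differences with equal cross sums have equal values. The converse fails in positive
    -- characteristic, so the other answer is only `nothing`.
    weaklyDecide : ∀ x y → Maybe (⟦ x ⟧ ≈ ⟦ y ⟧)
    weaklyDecide x y with plus x ℕ.+ minus y ℕ.≟ plus y ℕ.+ minus x
    ... | no _ = nothing
    ... | yes eq = just (begin
      ⟦ x ⟧                                    ≈⟨ ⟦⟧-diff x ⟩
      fromℕ (plus x) - fromℕ (minus x)         ≈⟨ +-identityʳ _ ⟨
      (fromℕ (plus x) - fromℕ (minus x)) + 0#  ≈⟨ +-congˡ (-‿inverseʳ (fromℕ (minus y))) ⟨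
      (fromℕ (plus x) - fromℕ (minus x)) + (fromℕ (minus y) - fromℕ (minus y))
        ≈⟨ interchange _ _ _ _ ⟩
      (fromℕ (plus x) + fromℕ (minus y)) + (- fromℕ (minus x) - fromℕ (minus y))
        ≈⟨ +-cong (trans (sym (×-homo-+ 1# (plus x) (minus y)))
                    (trans (×-congˡ eq) (×-homo-+ 1# (plus y) (minus x))))
                  (+-comm _ _) ⟩
      (fromℕ (plus y) + fromℕ (minus x)) + (- fromℕ (minus y) - fromℕ (minus x))
        ≈⟨ interchange _ _ _ _ ⟩
      (fromℕ (plus y) - fromℕ (minus y)) + (fromℕ (minus x) - fromℕ (minus x))
        ≈⟨ +-congˡ (-‿inverseʳ (fromℕ (minus x))) ⟩
      (fromℕ (plus y) - fromℕ (minus y)) + 0#  ≈⟨ +-identityʳ _ ⟩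
      fromℕ (plus y) - fromℕ (minus y)         ≈⟨ ⟦⟧-diff y ⟨
      ⟦ y ⟧ ∎)

  open Algebra.Solver.Ring rawDifference (fromCommutativeRing A) homomorphism weaklyDecide public
    using (solve; _:=_; _:+_; _:*_; _:-_; :-_; con)
  :1 : ∀ {n} → Algebra.Solver.Ring.Polynomial rawDifference (fromCommutativeRing A) homomorphism weaklyDecide n
  :1 = con 𝟙

-- Roots of unity in a field with decidable equality, for use over both ℝ and ℂ.

record DiscreteField c ℓ : Set (L.suc (c ⊔ ℓ)) where
  field
    commutativeRing : CommutativeRing c ℓ
  open CommutativeRing commutativeRing public
  field
    -- This is what lets `root⇒power` search finitely many candidates for the one equal to `1#`.
    _≟_     : Decidable _≈_
    inverse : ∀ {x} → ¬ (x ≈ 0#) → ∃ λ y → y * x ≈ 1#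

module RootsOfUnity {c ℓ} (F : DiscreteField c ℓ) where

  open DiscreteField F hiding (zero)
  open Mult semiring using () renaming (_×_ to _·ℕ_)
  open Sum semiring
  open Exp commutativeSemiring
  open DifferenceSolver commutativeRing
  open SetoidReasoning setoid

  ^-zeroˡ : ∀ n → 1# ^ n ≈ 1#
  ^-zeroˡ zero    = refl
  ^-zeroˡ (suc n) = trans (*-identityˡ _) (^-zeroˡ n)

  ^-comm : ∀ x m n → (x ^ m) ^ n ≈ (x ^ n) ^ m
  ^-comm x m n = begin
    (x ^ m) ^ n    ≈⟨ ^-assocʳ x m n ⟩
    x ^ (m ℕ.* n)  ≈⟨ ^-congʳ x (ℕ.*-comm m n) ⟩
    x ^ (n ℕ.* m)  ≈⟨ ^-assocʳ x n m ⟨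
    (x ^ n) ^ m    ∎

  ^≈1⇒^∣≈1 : ∀ {x m n} → m ∣ n → x ^ m ≈ 1# → x ^ n ≈ 1#
  ^≈1⇒^∣≈1 {x} {m} (divides k ≡.refl) x^m≈1 = begin
    x ^ (k ℕ.* m)  ≈⟨ ^-congʳ x (ℕ.*-comm k m) ⟩
    x ^ (m ℕ.* k)  ≈⟨ ^-assocʳ x m k ⟨
    (x ^ m) ^ k    ≈⟨ ^-congˡ k x^m≈1 ⟩
    1# ^ k         ≈⟨ ^-zeroˡ k ⟩
    1#             ∎

  ^≈1⇒^^≈1 : ∀ {x} m n → x ^ n ≈ 1# → (x ^ m) ^ n ≈ 1#
  ^≈1⇒^^≈1 {x} m n x^n≈1 = trans (^-assocʳ x m n) (^≈1⇒^∣≈1 (divides m ≡.refl) x^n≈1)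

  *-cancelˡ-≈0 : ∀ {x y} → ¬ (x ≈ 0#) → x * y ≈ 0# → y ≈ 0#
  *-cancelˡ-≈0 {x} {y} x≉0 xy≈0 = let x⁻¹ , x⁻¹x≈1 = inverse x≉0 in begin
    y              ≈⟨ *-identityˡ y ⟨
    1# * y         ≈⟨ *-congʳ x⁻¹x≈1 ⟨
    x⁻¹ * x * y    ≈⟨ *-assoc x⁻¹ x y ⟩
    x⁻¹ * (x * y)  ≈⟨ *-congˡ xy≈0 ⟩
    x⁻¹ * 0#       ≈⟨ zeroʳ x⁻¹ ⟩
    0#             ∎

  -- Both sides are 1 + x + ... + x^n, split off at opposite ends. Without subtraction the identity
  -- goes through by direct induction.
  telescope : ∀ x n → 1# + x * ∑[ i < n ] (x ^ toℕ i) ≈ ∑[ i < n ] (x ^ toℕ i) + x ^ n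
  telescope x zero    = trans (+-congˡ (zeroʳ x)) (+-comm 1# 0#)
  telescope x (suc n) = begin
    1# + x * ∑[ i < suc n ] (x ^ toℕ i)                 ≈⟨ +-congˡ (*-congˡ ∑-suc) ⟩
    1# + x * (1# + x * ∑[ i < n ] (x ^ toℕ i))          ≈⟨ +-congˡ (*-congˡ (telescope x n)) ⟩
    1# + x * (∑[ i < n ] (x ^ toℕ i) + x ^ n)
      ≈⟨ solve 3 (λ x s y → :1 :+ x :* (s :+ y) := (:1 :+ x :* s) :+ x :* y)
           refl x (∑[ i < n ] (x ^ toℕ i)) (x ^ n) ⟩
    (1# + x * ∑[ i < n ] (x ^ toℕ i)) + x ^ suc n       ≈⟨ +-congʳ ∑-suc ⟨
    ∑[ i < suc n ] (x ^ toℕ i) + x ^ suc n              ∎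
    where
    ∑-suc : ∑[ i < suc n ] (x ^ toℕ i) ≈ 1# + x * ∑[ i < n ] (x ^ toℕ i)
    ∑-suc = +-congˡ (sym (*-distribˡ-sum x (λ (i : Fin n) → x ^ toℕ i)))

  geometric-sum : ∀ {x} n → x ^ n ≈ 1# → ¬ (x ≈ 1#) → ∑[ i < n ] (x ^ toℕ i) ≈ 0#
  geometric-sum {x} n x^n≈1 x≉1 = *-cancelˡ-≈0 x-1≉0 (begin
    (x - 1#) * s       ≈⟨ solve 2 (λ x s → (x :- :1) :* s := (:1 :+ x :* s) :- s :- :1) refl x s ⟩
    1# + x * s - s - 1#  ≈⟨ +-congʳ (+-congʳ (trans (telescope x n) (+-congˡ x^n≈1))) ⟩
    s + 1# - s - 1#    ≈⟨ solve 1 (λ s → s :+ :1 :- s :- :1 := con 𝟘) refl s ⟩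
    0#                 ∎)
    where
    s = ∑[ i < n ] (x ^ toℕ i)
    x-1≉0 : ¬ (x - 1# ≈ 0#)
    x-1≉0 x-1≈0 = x≉1 (begin
      x              ≈⟨ solve 1 (λ x → x := (x :- :1) :+ :1) refl x ⟩
      x - 1# + 1#    ≈⟨ +-congʳ x-1≈0 ⟩
      0# + 1#        ≈⟨ +-identityˡ 1# ⟩
      1#             ∎)

  record Primitive (n : ℕ) (ω : Carrier) : Set ℓ where
    field
      ^-order : ω ^ n ≈ 1#
      minimal : ∀ {k} → 0 ℕ.< k → k ℕ.< n → ¬ (ω ^ k ≈ 1#)

  module _ {n ω} .{{_ : NonZero n}} (prim : Primitive n ω) where
    open Primitive prim

    ^-% : ∀ k → ω ^ k ≈ ω ^ (k % n)
    ^-% k = begin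
      ω ^ k                                   ≈⟨ ^-congʳ ω (m≡m%n+[m/n]*n k n) ⟩
      ω ^ (k % n ℕ.+ k / n ℕ.* n)             ≈⟨ ^-homo-* ω (k % n) (k / n ℕ.* n) ⟩
      ω ^ (k % n) * ω ^ (k / n ℕ.* n)         ≈⟨ *-congˡ (^≈1⇒^∣≈1 (divides (k / n) ≡.refl) ^-order) ⟩
      ω ^ (k % n) * 1#                        ≈⟨ *-identityʳ _ ⟩
      ω ^ (k % n)                             ∎

    private
      -- The power `ω ^ (n ∸ i)` inverts `ω ^ i`, so equal powers give `ω ^ (j ∸ i) ≈ 1#`, which
      -- minimality forbids unless the exponent is 0.
      ^-injective-≤ : ∀ {i j} → i ℕ.≤ j → j ℕ.< n → ω ^ i ≈ ω ^ j → i ≡ j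
      ^-injective-≤ {i} {j} i≤j j<n eq with j ℕ.∸ i in j∸i
      ... | zero  = ℕ.≤-antisym i≤j (ℕ.m∸n≡0⇒m≤n j∸i)
      ... | suc d = ⊥-elim (minimal {j ℕ.∸ i} (≡.subst (0 ℕ.<_) (≡.sym j∸i) (s≤s z≤n))
                              (ℕ.≤-<-trans (ℕ.m∸n≤m j i) j<n) ω^[j∸i]≈1)
        where
        i≤n = ℕ.<⇒≤ (ℕ.≤-<-trans i≤j j<n)
        cancel : ω ^ (n ℕ.∸ i) * ω ^ i ≈ 1#
        cancel = begin
          ω ^ (n ℕ.∸ i) * ω ^ i  ≈⟨ ^-homo-* ω (n ℕ.∸ i) i ⟨
          ω ^ (n ℕ.∸ i ℕ.+ i)    ≈⟨ ^-congʳ ω (ℕ.m∸n+n≡m i≤n) ⟩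
          ω ^ n                ≈⟨ ^-order ⟩
          1#                   ∎
        ω^[j∸i]≈1 : ω ^ (j ℕ.∸ i) ≈ 1#
        ω^[j∸i]≈1 = begin
          ω ^ (j ℕ.∸ i)                          ≈⟨ *-identityˡ _ ⟨
          1# * ω ^ (j ℕ.∸ i)                     ≈⟨ *-congʳ cancel ⟨
          ω ^ (n ℕ.∸ i) * ω ^ i * ω ^ (j ℕ.∸ i)    ≈⟨ *-assoc _ _ _ ⟩
          ω ^ (n ℕ.∸ i) * (ω ^ i * ω ^ (j ℕ.∸ i))  ≈⟨ *-congˡ (^-homo-* ω i (j ℕ.∸ i)) ⟨
          ω ^ (n ℕ.∸ i) * ω ^ (i ℕ.+ (j ℕ.∸ i))    ≈⟨ *-congˡ (^-congʳ ω (ℕ.m+[n∸m]≡n i≤j)) ⟩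
          ω ^ (n ℕ.∸ i) * ω ^ j                  ≈⟨ *-congˡ eq ⟨
          ω ^ (n ℕ.∸ i) * ω ^ i                  ≈⟨ cancel ⟩
          1#                                   ∎

    ^-injective : ∀ {i j} → i ℕ.< n → j ℕ.< n → ω ^ i ≈ ω ^ j → i ≡ j
    ^-injective {i} {j} i<n j<n eq with ℕ.≤-total i j
    ... | inj₁ i≤j = ^-injective-≤ i≤j j<n eq
    ... | inj₂ j≤i = ≡.sym (^-injective-≤ j≤i i<n (sym eq))

  -- If no z ω ^ i is 1, then summing (z ω ^ i) ^ k over i and k gives 0 when k
  -- runs first, and n (from k = 0) when i runs first.
  root⇒power : ∀ {n ω} .{{_ : NonZero n}} → ¬ (n ·ℕ 1# ≈ 0#) → Primitive n ω →
               ∀ {z} → z ^ n ≈ 1# → ∃ λ k → k ℕ.< n × z ≈ ω ^ k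
  root⇒power {suc n-1} {ω} n≉0 prim {z} z^n≈1 =
    -- The remainder matters for `i` equal to 0, where `n ∸ toℕ i` is `n` itself and not below `n`.
    let i , zω^i≈1 = one-is-1 in (n ℕ.∸ toℕ i) % n , m%n<n (n ℕ.∸ toℕ i) n , (begin
      z                                   ≈⟨ *-identityʳ z ⟨
      z * 1#                              ≈⟨ *-congˡ ^-order ⟨
      z * ω ^ n                           ≈⟨ *-congˡ (^-congʳ ω (ℕ.m+[n∸m]≡n (ℕ.<⇒≤ (Fin.toℕ<n i)))) ⟨
      z * ω ^ (toℕ i ℕ.+ (n ℕ.∸ toℕ i))     ≈⟨ *-congˡ (^-homo-* ω (toℕ i) (n ℕ.∸ toℕ i)) ⟩
      z * (ω ^ toℕ i * ω ^ (n ℕ.∸ toℕ i))   ≈⟨ *-assoc _ _ _ ⟨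
      z * ω ^ toℕ i * ω ^ (n ℕ.∸ toℕ i)     ≈⟨ *-congʳ zω^i≈1 ⟩
      1# * ω ^ (n ℕ.∸ toℕ i)                ≈⟨ *-identityˡ _ ⟩
      ω ^ (n ℕ.∸ toℕ i)                     ≈⟨ ^-% prim (n ℕ.∸ toℕ i) ⟩
      ω ^ ((n ℕ.∸ toℕ i) % n)               ∎)
    where
    open Primitive prim
    n = suc n-1
    term : Fin n → Fin n → Carrier
    term i k = (z * ω ^ toℕ i) ^ toℕ k
    [zω^i]^n≈1 : ∀ i → (z * ω ^ i) ^ n ≈ 1#
    [zω^i]^n≈1 i = begin
      (z * ω ^ i) ^ n      ≈⟨ ^-distrib-* z (ω ^ i) n ⟩
      z ^ n * (ω ^ i) ^ n  ≈⟨ *-cong z^n≈1 (^≈1⇒^^≈1 i n ^-order) ⟩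
      1# * 1#              ≈⟨ *-identityˡ 1# ⟩
      1#                   ∎
    column : ∀ (k : Fin n-1) → ∑[ i < n ] term i (Fin.suc k) ≈ 0#
    column k = begin
      ∑[ i < n ] term i (Fin.suc k)
        ≈⟨ sum-cong-≋ (λ (i : Fin n) → trans (^-distrib-* z (ω ^ toℕ i) k′) (*-congˡ (^-comm ω (toℕ i) k′))) ⟩
      ∑[ i < n ] (z ^ k′ * (ω ^ k′) ^ toℕ i)
        ≈⟨ *-distribˡ-sum (z ^ k′) (λ (i : Fin n) → (ω ^ k′) ^ toℕ i) ⟨
      z ^ k′ * ∑[ i < n ] ((ω ^ k′) ^ toℕ i)
        ≈⟨ *-congˡ (geometric-sum n (^≈1⇒^^≈1 k′ n ^-order)
                     (minimal (s≤s z≤n) (s≤s (Fin.toℕ<n k)))) ⟩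
      z ^ k′ * 0#  ≈⟨ zeroʳ _ ⟩
      0# ∎
      where k′ = suc (toℕ k)
    columns : ∑[ i < n ] ∑[ k < n ] term i k ≈ n ·ℕ 1#
    columns = begin
      ∑[ i < n ] ∑[ k < n ] term i k              ≈⟨ ∑-comm term ⟩
      ∑[ i < n ] 1# + ∑[ k < n-1 ] ∑[ i < n ] term i (Fin.suc k)
        ≈⟨ +-cong (sum-replicate n) (trans (sum-cong-≋ column) (sum-replicate-zero n-1)) ⟩
      n ·ℕ 1# + 0#                                ≈⟨ +-identityʳ _ ⟩
      n ·ℕ 1#                                     ∎
    one-is-1 : ∃ λ (i : Fin n) → z * ω ^ toℕ i ≈ 1#
    one-is-1 with Fin.any? (λ (i : Fin n) → (z * ω ^ toℕ i) ≟ 1#)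
    ... | yes p = p
    ... | no ¬p = ⊥-elim (n≉0 (begin
      n ·ℕ 1#                         ≈⟨ columns ⟨
      ∑[ i < n ] ∑[ k < n ] term i k
        ≈⟨ sum-cong-≋ (λ (i : Fin n) → geometric-sum n ([zω^i]^n≈1 (toℕ i)) (λ eq → ¬p (i , eq))) ⟩
      ∑[ i < n ] 0#                   ≈⟨ sum-replicate-zero n ⟩
      0#                              ∎))

-- Order and division in ℝ.

module OrderedField {c ℓ₁ ℓ₂} (ℝ : CompleteOrderedField c ℓ₁ ℓ₂) where

  open RealProperties ℝ
  open DifferenceSolver commutativeRing
  private module O = OrderReasoning strictPartialOrder

  ≤-trans : ∀ {x y z} → x ≤ y → y ≤ z → x ≤ z
  ≤-trans {x} {y} {z} p q = O.begin x O.≤⟨ p ⟩ y O.≤⟨ q ⟩ z O.∎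

  <-≤-trans : ∀ {x y z} → x < y → y ≤ z → x < z
  <-≤-trans {x} {y} {z} p q = O.begin-strict x O.<⟨ p ⟩ y O.≤⟨ q ⟩ z O.∎

  <⇒≱ : ∀ {x y} → x < y → ¬ (y ≤ x)
  <⇒≱ p q = irrefl refl (<-≤-trans p q)

  ≮⇒≥ : ∀ {x y} → ¬ (x < y) → y ≤ x
  ≮⇒≥ {x} {y} x≮y with compare x y
  ... | tri< x<y _ _ = ⊥-elim (x≮y x<y)
  ... | tri≈ _ x≈y _ = inj₂ (sym x≈y)
  ... | tri> _ _ y<x = inj₁ y<x

  0≤1 : 0# ≤ 1#
  0≤1 = inj₁ 0<1

  pos⇒≉0 : ∀ {x} → 0# < x → ¬ (x ≈ 0#)
  pos⇒≉0 0<x x≈0 = irrefl (sym x≈0) 0<x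

  difference-pos : ∀ {x y d} → 0# < d → x + d ≈ y → x < y
  difference-pos {x} {y} {d} 0<d x+d≈y = O.begin-strict
    x       O.≈⟨ sym (+-identityˡ x) ⟩
    0# + x  O.<⟨ +-monoˡ-< x 0<d ⟩
    d + x   O.≈⟨ trans (+-comm d x) x+d≈y ⟩
    y       O.∎

  difference-nonneg : ∀ {x y d} → 0# ≤ d → x + d ≈ y → x ≤ y
  difference-nonneg (inj₁ 0<d) x+d≈y = inj₁ (difference-pos 0<d x+d≈y)
  difference-nonneg {x} (inj₂ 0≈d) x+d≈y =
    inj₂ (trans (sym (+-identityʳ x)) (trans (+-congˡ 0≈d) x+d≈y))

  <⇒0<- : ∀ {x y} → x < y → 0# < y - x
  <⇒0<- {x} {y} x<y = O.begin-strict
    0#     O.≈⟨ sym (-‿inverseʳ x) ⟩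
    x - x  O.<⟨ +-monoˡ-< (- x) x<y ⟩
    y - x  O.∎

  ≤⇒0≤- : ∀ {x y} → x ≤ y → 0# ≤ y - x
  ≤⇒0≤- (inj₁ x<y) = inj₁ (<⇒0<- x<y)
  ≤⇒0≤- {x} {y} (inj₂ x≈y) = inj₂ (trans (sym (-‿inverseʳ x)) (+-congʳ x≈y))

  +-pos-nonneg : ∀ {x y} → 0# < x → 0# ≤ y → 0# < x + y
  +-pos-nonneg 0<x 0≤y = <-≤-trans 0<x (difference-nonneg 0≤y refl)

  *-nonneg : ∀ {x y} → 0# ≤ x → 0# ≤ y → 0# ≤ x * y
  *-nonneg (inj₁ p) (inj₁ q) = inj₁ (*-pos p q)
  *-nonneg {x} {y} (inj₂ p) _ = inj₂ (trans (sym (zeroˡ y)) (*-congʳ p))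
  *-nonneg {x} {y} (inj₁ _) (inj₂ q) = inj₂ (trans (sym (zeroʳ x)) (*-congˡ q))

  *-cancelˡ-< : ∀ {z x y} → 0# < z → z * x < z * y → x < y
  *-cancelˡ-< {z} {x} {y} 0<z zx<zy with compare x y
  ... | tri< x<y _ _ = x<y
  ... | tri≈ _ x≈y _ = ⊥-elim (irrefl (*-congˡ x≈y) zx<zy)
  ... | tri> _ _ y<x = ⊥-elim (<⇒≱ zx<zy (inj₁ (difference-pos (*-pos 0<z (<⇒0<- y<x))
    (solve 3 (λ z x y → z :* y :+ z :* (x :- y) := z :* x) refl z x y))))

  0<quotient : ∀ {x y} → 0# < x → 0# < y → ∃ λ z → 0# < z × y * z ≈ x
  0<quotient {x} {y} 0<x 0<y = x * y ⁻¹ , *-cancelˡ-< 0<y (O.begin-strict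
      y * 0#           O.≈⟨ zeroʳ y ⟩
      0#               O.<⟨ 0<x ⟩
      x                O.≈⟨ sym eq ⟩
      y * (x * y ⁻¹)   O.∎) , eq
    where
    eq : y * (x * y ⁻¹) ≈ x
    eq = O.begin-equality
      y * (x * y ⁻¹)  O.≈⟨ solve 3 (λ y x z → y :* (x :* z) := x :* (y :* z)) refl y x (y ⁻¹) ⟩
      x * (y * y ⁻¹)  O.≈⟨ *-congˡ (*-inverseʳ (pos⇒≉0 0<y)) ⟩
      x * 1#          O.≈⟨ *-identityʳ x ⟩
      x               O.∎

  inverse : ∀ {x} → ¬ (x ≈ 0#) → ∃ λ y → y * x ≈ 1#
  inverse {x} x≉0 = x ⁻¹ , trans (*-comm _ x) (*-inverseʳ x≉0)

  _≟_ : Decidable _≈_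
  x ≟ y with compare x y
  ... | tri< _ x≉y _ = no x≉y
  ... | tri≈ _ x≈y _ = yes x≈y
  ... | tri> _ x≉y _ = no x≉y

  discreteField : DiscreteField c ℓ₁
  discreteField = record { commutativeRing = commutativeRing ; _≟_ = _≟_ ; inverse = inverse }

  fromℕ-nonneg : ∀ n → 0# ≤ fromℕ n
  fromℕ-nonneg zero    = inj₂ refl
  fromℕ-nonneg (suc n) = +-nonneg 0≤1 (fromℕ-nonneg n)

  fromℕ-pos : ∀ n .{{_ : NonZero n}} → 0# < fromℕ n
  fromℕ-pos (suc n) = +-pos-nonneg 0<1 (fromℕ-nonneg n)

  -- Zeros of functions that cannot increase too fast.

  module _ (f : Carrier → Carrier) (f-cong : ∀ {x y} → x ≈ y → f x ≈ f y)
    {L} (0<L : 0# < L) (lipschitz : ∀ {x y} → 0# ≤ x → x ≤ y → y ≤ 1# → f y ≤ f x + L * (y - x))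
    where

    -- The zero is the supremum of the points of [a, 1] where `f` is at most 0; being an upper
    -- bound, it leaves only positive values to its right. A bound on the growth of `f` is enough,
    -- since a fast decrease cannot spoil either half of the argument.
    last-zero : ∀ {a} → 0# ≤ a → a ≤ 1# → f a < 0# → 0# < f 1# →
                ∃ λ r → a < r × r < 1# × f r ≈ 0# × (∀ x → r < x → x ≤ 1# → 0# < f x)
    last-zero {a} 0≤a a≤1 fa<0 0<f1 = r , a<r , r<1 , fr≈0 , after
      where
      S : Carrier → Set _
      S x = Lift (c ⊔ ℓ₁ ⊔ ℓ₂) (a ≤ x × x ≤ 1# × f x ≤ 0#)
      lub : ∃ (LeastUpperBound S)
      lub = supremum S (a , lift (inj₂ refl , a≤1 , inj₁ fa<0)) (1# , λ { _ (lift (_ , x≤1 , _)) → x≤1 })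
      r = proj₁ lub
      upper = proj₁ (proj₂ lub)
      least = proj₂ (proj₂ lub)
      a≤r : a ≤ r
      a≤r = upper a (lift (inj₂ refl , a≤1 , inj₁ fa<0))
      r≤1 : r ≤ 1#
      r≤1 = least 1# (λ { _ (lift (_ , x≤1 , _)) → x≤1 })
      -- With δ = f r / L the growth bound keeps `f` positive on the part of (r - δ, r] above `a`,
      -- so `r - δ` would be a smaller upper bound of `S`.
      fr≯0 : ¬ (0# < f r)
      fr≯0 0<fr = let δ , 0<δ , Lδ≈fr = 0<quotient 0<fr 0<L in
        <⇒≱ (difference-pos 0<δ (solve 2 (λ r d → (r :- d) :+ d := r) refl r δ))
          (least (r - δ) (λ { x (lift x∈S@(a≤x , x≤1 , fx≤0)) → ≮⇒≥ λ r-δ<x →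
            <⇒≱ (O.begin-strict
              f x + L * (r - x)
                O.<⟨ difference-pos (+-pos-nonneg (*-pos 0<L (<⇒0<- r-δ<x)) (≤⇒0≤- fx≤0))
                       (solve 5 (λ fx L r x d →
                          (fx :+ L :* (r :- x)) :+ (L :* (x :- (r :- d)) :+ (con 𝟘 :- fx)) := L :* d)
                          refl (f x) L r x δ) ⟩
              L * δ              O.≈⟨ Lδ≈fr ⟩
              f r                O.∎)
            (lipschitz (≤-trans 0≤a a≤x) (upper x (lift x∈S)) r≤1) }))
      -- With ε = - f r / L the growth bound gives f (r + ε) ≤ 0, so `r + ε` would be a member of
      -- `S` beyond its supremum. That it stays below 1 follows from 0 < f 1 and the growth bound
      -- between `r` and 1.
      fr≮0 : ¬ (f r < 0#)
      fr≮0 fr<0 = let ε , 0<ε , Lε≈ = 0<quotient (<⇒0<- fr<0) 0<L in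
        let r<r+ε = difference-pos 0<ε refl
            ε<1-r = *-cancelˡ-< 0<L (O.begin-strict
              L * ε         O.≈⟨ Lε≈ ⟩
              0# - f r      O.<⟨ +-monoˡ-< (- f r) 0<f1 ⟩
              f 1# - f r
                O.≤⟨ difference-nonneg (≤⇒0≤- (lipschitz (≤-trans 0≤a a≤r) r≤1 (inj₂ refl)))
                       (solve 3 (λ u v w → (u :- v) :+ ((v :+ w) :- u) := w) refl (f 1#) (f r) (L * (1# - r))) ⟩
              L * (1# - r)  O.∎)
            r+ε≤1 = inj₁ (difference-pos (<⇒0<- ε<1-r)
              (solve 2 (λ r e → (r :+ e) :+ ((:1 :- r) :- e) := :1) refl r ε))
            f[r+ε]≤0 = O.begin
              f (r + ε)                O.≤⟨ lipschitz (≤-trans 0≤a a≤r) (inj₁ r<r+ε) r+ε≤1 ⟩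
              f r + L * ((r + ε) - r)
                O.≈⟨ solve 4 (λ u L r e → u :+ L :* ((r :+ e) :- r) := u :+ L :* e) refl (f r) L r ε ⟩
              f r + L * ε              O.≈⟨ +-congˡ Lε≈ ⟩
              f r + (0# - f r)         O.≈⟨ solve 1 (λ u → u :+ (con 𝟘 :- u) := con 𝟘) refl (f r) ⟩
              0#                       O.∎
        in <⇒≱ r<r+ε (upper (r + ε) (lift (≤-trans a≤r (inj₁ r<r+ε) , r+ε≤1 , f[r+ε]≤0)))
      fr≈0 : f r ≈ 0#
      fr≈0 with compare (f r) 0#
      ... | tri< fr<0 _ _ = ⊥-elim (fr≮0 fr<0)
      ... | tri≈ _ fr≈0 _ = fr≈0
      ... | tri> _ _ 0<fr = ⊥-elim (fr≯0 0<fr)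
      a<r : a < r
      a<r with a≤r
      ... | inj₁ a<r = a<r
      ... | inj₂ a≈r = ⊥-elim (irrefl (trans (f-cong a≈r) fr≈0) fa<0)
      r<1 : r < 1#
      r<1 with r≤1
      ... | inj₁ r<1 = r<1
      ... | inj₂ r≈1 = ⊥-elim (irrefl (trans (sym fr≈0) (f-cong r≈1)) 0<f1)
      after : ∀ x → r < x → x ≤ 1# → 0# < f x
      after x r<x x≤1 with compare 0# (f x)
      ... | tri< 0<fx _ _ = 0<fx
      ... | tri≈ _ 0≈fx _ =
        ⊥-elim (<⇒≱ r<x (upper x (lift (≤-trans a≤r (inj₁ r<x) , x≤1 , inj₂ (sym 0≈fx)))))
      ... | tri> _ _ fx<0 =
        ⊥-elim (<⇒≱ r<x (upper x (lift (≤-trans a≤r (inj₁ r<x) , x≤1 , inj₁ fx<0))))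

  -- Two variables, because divided differences have two. Bounding `g` and its negative together
  -- stands in for the absolute value and makes the class closed under negation.
  Bounded : (Carrier → Carrier → Carrier) → Set _
  Bounded g = ∃ λ b → 0# ≤ b × (∀ {x y} → 0# ≤ x → x ≤ 1# → 0# ≤ y → y ≤ 1# →
                                  g x y ≤ b × - g x y ≤ b)

  scaled-≤ : ∀ {x u b} → 0# ≤ x → x ≤ 1# → 0# ≤ b → u ≤ b → x * u ≤ b
  scaled-≤ {x} {u} {b} 0≤x x≤1 0≤b u≤b =
    difference-nonneg (+-nonneg (*-nonneg 0≤x (≤⇒0≤- u≤b)) (*-nonneg (≤⇒0≤- x≤1) 0≤b))
      (solve 3 (λ x u b → x :* u :+ (x :* (b :- u) :+ (:1 :- x) :* b) := b) refl x u b)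

  +-mono-≤ : ∀ {x y u v} → x ≤ y → u ≤ v → x + u ≤ y + v
  +-mono-≤ {x} {y} {u} {v} x≤y u≤v = difference-nonneg (+-nonneg (≤⇒0≤- x≤y) (≤⇒0≤- u≤v))
    (solve 4 (λ x y u v → (x :+ u) :+ ((y :- x) :+ (v :- u)) := y :+ v) refl x y u v)

  ≈-≤-trans : ∀ {x y z} → x ≈ y → y ≤ z → x ≤ z
  ≈-≤-trans x≈y = ≤-trans (inj₂ x≈y)

  bounded-0 : Bounded (λ _ _ → 0#)
  bounded-0 = 0# , inj₂ refl , λ _ _ _ _ →
    inj₂ refl , inj₂ (solve 0 (:- con 𝟘 := con 𝟘) refl)

  bounded-1 : Bounded (λ _ _ → 1#)
  bounded-1 = 1# , 0≤1 , λ _ _ _ _ →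
    inj₂ refl , difference-nonneg (+-nonneg 0≤1 0≤1) (solve 0 (:- :1 :+ (:1 :+ :1) := :1) refl)

  bounded-+ : ∀ {g h} → Bounded g → Bounded h → Bounded (λ x y → g x y + h x y)
  bounded-+ {g} {h} (b , 0≤b , g≤b) (d , 0≤d , h≤d) = b + d , +-nonneg 0≤b 0≤d ,
    λ {x} {y} 0≤x x≤1 0≤y y≤1 → let g≤ , -g≤ = g≤b 0≤x x≤1 0≤y y≤1
                                    h≤ , -h≤ = h≤d 0≤x x≤1 0≤y y≤1 in
      +-mono-≤ g≤ h≤ ,
      ≈-≤-trans (solve 2 (λ u v → :- (u :+ v) := :- u :+ :- v) refl (g x y) (h x y)) (+-mono-≤ -g≤ -h≤)

  bounded-neg : ∀ {g} → Bounded g → Bounded (λ x y → - g x y)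
  bounded-neg {g} (b , 0≤b , g≤b) = b , 0≤b , λ {x} {y} 0≤x x≤1 0≤y y≤1 →
    let g≤ , -g≤ = g≤b 0≤x x≤1 0≤y y≤1 in
    -g≤ , ≈-≤-trans (solve 1 (λ u → :- (:- u) := u) refl (g x y)) g≤

  bounded-scale₁ : ∀ {g} → Bounded g → Bounded (λ x y → x * g x y)
  bounded-scale₁ {g} (b , 0≤b , g≤b) = b , 0≤b , λ {x} {y} 0≤x x≤1 0≤y y≤1 →
    let g≤ , -g≤ = g≤b 0≤x x≤1 0≤y y≤1 in
    scaled-≤ 0≤x x≤1 0≤b g≤ ,
    ≈-≤-trans (solve 2 (λ x u → :- (x :* u) := x :* (:- u)) refl x (g x y)) (scaled-≤ 0≤x x≤1 0≤b -g≤)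

  bounded-flip : ∀ {g} → Bounded g → Bounded (λ x y → g y x)
  bounded-flip (b , 0≤b , g≤b) = b , 0≤b , λ 0≤x x≤1 0≤y y≤1 → g≤b 0≤y y≤1 0≤x x≤1

  bounded-scale₂ : ∀ {g} → Bounded g → Bounded (λ x y → y * g x y)
  bounded-scale₂ b = bounded-flip (bounded-scale₁ (bounded-flip b))

  -- Chebyshev polynomials and their largest roots.

  -- V k is U (k - 1) for the Chebyshev polynomials U of the second kind:
  -- V k (cos θ) sin θ = sin (k θ).
  V : ℕ → Carrier → Carrier
  V 0             x = 0#
  V 1             x = 1#
  V (suc (suc k)) x = (x * V (suc k) x + x * V (suc k) x) - V k x

  V-cong : ∀ k {x y} → x ≈ y → V k x ≈ V k y
  V-cong 0             x≈y = refl
  V-cong 1             x≈y = refl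
  V-cong (suc (suc k)) x≈y =
    +-cong (+-cong (*-cong x≈y (V-cong (suc k) x≈y)) (*-cong x≈y (V-cong (suc k) x≈y)))
           (-‿cong (V-cong k x≈y))

  -- Supplies the positive value at the right end of the interval that `last-zero` searches.
  V-at-1 : ∀ k → V k 1# ≈ fromℕ k
  V-at-1 0             = refl
  V-at-1 1             = sym (+-identityʳ 1#)
  V-at-1 (suc (suc k)) = trans
    (+-cong (+-cong (*-congˡ (V-at-1 (suc k))) (*-congˡ (V-at-1 (suc k)))) (-‿cong (V-at-1 k)))
    (solve 1 (λ n → (:1 :* (:1 :+ n) :+ :1 :* (:1 :+ n)) :- n := :1 :+ (:1 :+ n)) refl (fromℕ k))

  -- The divided difference (V k y - V k x) / (y - x) as a polynomial. Its recurrence is that of `V`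
  -- at y minus that at x, using y v(y) - x v(x) = y (v(y) - v(x)) + (y - x) v(x).
  ΔV : ℕ → Carrier → Carrier → Carrier
  ΔV 0             x y = 0#
  ΔV 1             x y = 0#
  ΔV (suc (suc k)) x y =
    ((y * ΔV (suc k) x y + y * ΔV (suc k) x y) - ΔV k x y) + (V (suc k) x + V (suc k) x)

  V-difference : ∀ k x y → V k y ≈ V k x + (y - x) * ΔV k x y
  V-difference 0 x y = solve 2 (λ x y → con 𝟘 := con 𝟘 :+ (y :- x) :* con 𝟘) refl x y
  V-difference 1 x y = solve 2 (λ x y → :1 := :1 :+ (y :- x) :* con 𝟘) refl x y
  V-difference (suc (suc k)) x y with V-difference (suc k) x y | V-difference k x y
  ... | ih₁ | ih₀ = O.begin-equality
    (y * V (suc k) y + y * V (suc k) y) - V k y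
      O.≈⟨ +-cong (+-cong (*-congˡ ih₁) (*-congˡ ih₁)) (-‿cong ih₀) ⟩
    (y * (v₁ + (y - x) * d₁) + y * (v₁ + (y - x) * d₁)) - (v₀ + (y - x) * d₀)
      O.≈⟨ solve 6 (λ x y v₁ d₁ v₀ d₀ →
        (y :* (v₁ :+ (y :- x) :* d₁) :+ y :* (v₁ :+ (y :- x) :* d₁)) :- (v₀ :+ (y :- x) :* d₀)
        := ((x :* v₁ :+ x :* v₁) :- v₀)
           :+ (y :- x) :* (((y :* d₁ :+ y :* d₁) :- d₀) :+ (v₁ :+ v₁))) refl x y v₁ d₁ v₀ d₀ ⟩
    V (suc (suc k)) x + (y - x) * ΔV (suc (suc k)) x y O.∎
    where
    v₁ = V (suc k) x
    v₀ = V k x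
    d₁ = ΔV (suc k) x y
    d₀ = ΔV k x y

  V-bounded : ∀ k → Bounded (λ x _ → V k x)
  V-bounded 0 = bounded-0
  V-bounded 1 = bounded-1
  V-bounded (suc (suc k)) =
    bounded-+ (bounded-+ (bounded-scale₁ (V-bounded (suc k))) (bounded-scale₁ (V-bounded (suc k))))
              (bounded-neg (V-bounded k))

  ΔV-bounded : ∀ k → Bounded (ΔV k)
  ΔV-bounded 0 = bounded-0
  ΔV-bounded 1 = bounded-0
  ΔV-bounded (suc (suc k)) =
    bounded-+
      (bounded-+
        (bounded-+ (bounded-scale₂ (ΔV-bounded (suc k))) (bounded-scale₂ (ΔV-bounded (suc k))))
        (bounded-neg (ΔV-bounded k)))
      (bounded-+ (V-bounded (suc k)) (V-bounded (suc k)))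

  V-lipschitz : ∀ k → ∃ λ L → 0# < L ×
    (∀ {x y} → 0# ≤ x → x ≤ y → y ≤ 1# → V k y ≤ V k x + L * (y - x))
  V-lipschitz k with ΔV-bounded k
  -- The added 1 makes the constant positive even when `b` is 0, as it is for the constant
  -- polynomials `V 0` and `V 1`.
  ... | b , 0≤b , ΔV≤b = 1# + b , +-pos-nonneg 0<1 0≤b , λ {x} {y} 0≤x x≤y y≤1 →
    ≈-≤-trans (V-difference k x y)
      (difference-nonneg
        (*-nonneg (≤⇒0≤- x≤y)
          (+-nonneg 0≤1 (≤⇒0≤- (proj₁ (ΔV≤b 0≤x (≤-trans x≤y y≤1) (≤-trans 0≤x x≤y) y≤1)))))
        (solve 5 (λ v x y d b → (v :+ (y :- x) :* d) :+ (y :- x) :* (:1 :+ (b :- d))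
                              := v :+ (:1 :+ b) :* (y :- x)) refl (V k x) x y (ΔV k x y) b))

  -- r is cos (π / (m + 2)).
  record LargestRoot (m : ℕ) : Set (c ⊔ ℓ₁ ⊔ ℓ₂) where
    field
      r        : Carrier
      0≤r      : 0# ≤ r
      r<1      : r < 1#
      zero-at  : V (suc (suc m)) r ≈ 0#
      pos-at   : ∀ {k} → k ℕ.≤ m → 0# < V (suc k) r
      pos-past : ∀ {x k} → r < x → x ≤ 1# → k ℕ.≤ suc m → 0# < V (suc k) x

  -- At r the recurrence gives V (m + 3) = - V (m + 1) < 0, while V (m + 3) is
  -- positive at 1: the next largest root lies strictly between.
  largestRoot : ∀ m → LargestRoot m
  largestRoot zero = record
    -- This is cos (π / 2), the only root of `V 2 x`, which is 2x.
    { r = 0#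
    ; 0≤r = inj₂ refl
    ; r<1 = 0<1
    ; zero-at = solve 0 ((con 𝟘 :* :1 :+ con 𝟘 :* :1) :- con 𝟘 := con 𝟘) refl
    ; pos-at = λ { z≤n → 0<1 }
    ; pos-past = λ { _ _ z≤n → 0<1
                   ; {x} 0<x _ (s≤s z≤n) → difference-pos (+-pos-nonneg 0<x (inj₁ 0<x))
                       (solve 1 (λ x → con 𝟘 :+ (x :+ x) := (x :* :1 :+ x :* :1) :- con 𝟘) refl x) }
    }
  largestRoot (suc m) =
    step (last-zero (V (3 ℕ.+ m)) (V-cong (3 ℕ.+ m)) (proj₁ (proj₂ lip)) (proj₂ (proj₂ lip))
           0≤r (inj₁ r<1) V[r]<0 0<V[1])
    where
    open LargestRoot (largestRoot m)
    lip = V-lipschitz (3 ℕ.+ m)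
    V[r]<0 : V (3 ℕ.+ m) r < 0#
    V[r]<0 = difference-pos (pos-at ℕ.≤-refl) (trans
      (+-congʳ (+-congʳ (trans (+-cong (*-congˡ zero-at) (*-congˡ zero-at))
        (solve 1 (λ r → r :* con 𝟘 :+ r :* con 𝟘 := con 𝟘) refl r))))
      (solve 1 (λ v → (con 𝟘 :- v) :+ v := con 𝟘) refl (V (suc m) r)))
    0<V[1] : 0# < V (3 ℕ.+ m) 1#
    0<V[1] = <-≤-trans (fromℕ-pos (3 ℕ.+ m)) (inj₂ (sym (V-at-1 (3 ℕ.+ m))))
    step : (∃ λ r′ → r < r′ × r′ < 1# × V (3 ℕ.+ m) r′ ≈ 0# ×
              (∀ x → r′ < x → x ≤ 1# → 0# < V (3 ℕ.+ m) x)) → LargestRoot (suc m)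
    step (r′ , r<r′ , r′<1 , V[r′]≈0 , 0<V) = record
      { r = r′
      ; 0≤r = ≤-trans 0≤r (inj₁ r<r′)
      ; r<1 = r′<1
      ; zero-at = V[r′]≈0
      -- The new root lies past the old one, so the positivity past `r` carried by the induction
      -- becomes positivity at `r′`.
      ; pos-at = pos-past r<r′ (inj₁ r′<1)
      ; pos-past = past
      }
      where
      past : ∀ {x k} → r′ < x → x ≤ 1# → k ℕ.≤ suc (suc m) → 0# < V (suc k) x
      past {x} r′<x x≤1 k≤ with ℕ.m≤n⇒m<n∨m≡n k≤
      ... | inj₁ (s≤s k≤1+m) = pos-past (<-trans r<r′ r′<x) x≤1 k≤1+m
      ... | inj₂ ≡.refl      = 0<V x r′<x x≤1

  -- The recurrence preserves this determinant. In trigonometric terms it is sin²((k+1)θ) - sin(kθ)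
  -- sin((k+2)θ) = sin²θ, divided by sin²θ.
  V-cassini : ∀ k x → V (suc k) x * V (suc k) x - V k x * V (suc (suc k)) x ≈ 1#
  V-cassini zero    x =
    solve 1 (λ x → :1 :* :1 :- con 𝟘 :* ((x :* :1 :+ x :* :1) :- con 𝟘) := :1) refl x
  V-cassini (suc k) x =
    trans (solve 3 (λ x u v → let w = (x :* v :+ x :* v) :- u in
             w :* w :- v :* ((x :* w :+ x :* w) :- v) := v :* v :- u :* w)
             refl x (V k x) (V (suc k) x))
      (V-cassini k x)

-- Arithmetic of the exponents.

-- Exponents e ≡ (1 mod p, 0 mod q) and e′ ≡ (0 mod p, 1 mod q): raising a pq-th
-- root of unity to them projects it to its p-part and its q-part.
crt-exponents : ∀ {p q} .{{_ : NonZero p}} .{{_ : NonZero q}} → Coprime p q →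
                ∃₂ λ e e′ → q ∣ e × p ∣ e′ × ∃ λ k → e ℕ.+ e′ ≡ 1 ℕ.+ k ℕ.* (p ℕ.* q)
crt-exponents {p@(suc p-1)} {q@(suc q-1)} coprime with coprime-Bézout coprime
... | Bézout.+- x y eq = w ℕ.* (y ℕ.* q) , x ℕ.* p , divides (w ℕ.* y) (≡.sym (ℕ.*-assoc w y q)) ,
        divides x ≡.refl , y ℕ.* q ,
        ≡.trans (≡.cong (w ℕ.* (y ℕ.* q) ℕ.+_) (≡.sym eq)) (rearrange w (y ℕ.* q))
  where
  -- Here `1 + w` is `p * q`, so multiplying by `w` is negation modulo `p * q`. This turns the
  -- Bézout relation 1 + y q = x p into a sum of natural numbers.
  w = q-1 ℕ.+ p-1 ℕ.* q
  rearrange : ∀ w u → w ℕ.* u ℕ.+ (1 ℕ.+ u) ≡ 1 ℕ.+ u ℕ.* (1 ℕ.+ w)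
  rearrange = solve-∀
... | Bézout.-+ x y eq = y ℕ.* q , w ℕ.* (x ℕ.* p) , divides y ≡.refl ,
        divides (w ℕ.* x) (≡.sym (ℕ.*-assoc w x p)) , x ℕ.* p ,
        ≡.trans (≡.cong (ℕ._+ w ℕ.* (x ℕ.* p)) (≡.sym eq)) (rearrange w (x ℕ.* p))
  where
  w = q-1 ℕ.+ p-1 ℕ.* q
  rearrange : ∀ w u → (1 ℕ.+ u) ℕ.+ w ℕ.* u ≡ 1 ℕ.+ u ℕ.* (1 ℕ.+ w)
  rearrange = solve-∀

-- The field of complex numbers: conjugation and the squared modulus.

module ComplexField {c ℓ₁ ℓ₂} (R : CompleteOrderedField c ℓ₁ ℓ₂) where

  module ℝ where
    open RealProperties R public
    open OrderedField R public
    open DifferenceSolver commutativeRing public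
    open Mult semiring public using (×-congʳ; ×-congˡ; ×-assoc-*; ×1-homo-*)
    open Sum semiring public using (sum-cong-≋)
    open RootsOfUnity discreteField public using (*-cancelˡ-≈0; geometric-sum)
  open Complex R
  open ℝ using (solve; _:=_; _:+_; _:*_; _:-_; :-_; con; :1)

  complexRing : CommutativeRing c ℓ₁
  complexRing = record
    { Carrier = ℂ ; _≈_ = _≈_ ; _+_ = _+_ ; _*_ = _*_ ; -_ = -_ ; 0# = 0# ; 1# = 1#
    ; isCommutativeRing = record
      { isRing = record
        { +-isAbelianGroup = record
          { isGroup = record
            { isMonoid = record
              { isSemigroup = record
                { isMagma = record
                  { isEquivalence = record
                    { refl = ℝ.refl , ℝ.refl
                    ; sym = λ (p , q) → ℝ.sym p , ℝ.sym q
                    ; trans = λ (p , q) (p′ , q′) → ℝ.trans p p′ , ℝ.trans q q′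
                    }
                  ; ∙-cong = λ (p , q) (p′ , q′) → ℝ.+-cong p p′ , ℝ.+-cong q q′
                  }
                ; assoc = λ z w v → ℝ.+-assoc _ _ _ , ℝ.+-assoc _ _ _
                }
              ; identity = (λ z → ℝ.+-identityˡ _ , ℝ.+-identityˡ _)
                         , (λ z → ℝ.+-identityʳ _ , ℝ.+-identityʳ _)
              }
            ; inverse = (λ z → ℝ.-‿inverseˡ _ , ℝ.-‿inverseˡ _)
                      , (λ z → ℝ.-‿inverseʳ _ , ℝ.-‿inverseʳ _)
            ; ⁻¹-cong = λ (p , q) → ℝ.-‿cong p , ℝ.-‿cong q
            }
          ; comm = λ z w → ℝ.+-comm _ _ , ℝ.+-comm _ _
          }
        ; *-cong = λ (p , q) (p′ , q′) →
            ℝ.+-cong (ℝ.*-cong p p′) (ℝ.-‿cong (ℝ.*-cong q q′)) ,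
            ℝ.+-cong (ℝ.*-cong p q′) (ℝ.*-cong q p′)
        ; *-assoc = λ z w v →
            solve 6 (λ a b c d e f → (a :* c :- b :* d) :* e :- (a :* d :+ b :* c) :* f
                                  := a :* (c :* e :- d :* f) :- b :* (c :* f :+ d :* e))
              ℝ.refl (re z) (im z) (re w) (im w) (re v) (im v) ,
            solve 6 (λ a b c d e f → (a :* c :- b :* d) :* f :+ (a :* d :+ b :* c) :* e
                                  := a :* (c :* f :+ d :* e) :+ b :* (c :* e :- d :* f))
              ℝ.refl (re z) (im z) (re w) (im w) (re v) (im v)
        ; *-identity =
            (λ z → solve 2 (λ a b → :1 :* a :- con 𝟘 :* b := a) ℝ.refl (re z) (im z) ,
                   solve 2 (λ a b → :1 :* b :+ con 𝟘 :* a := b) ℝ.refl (re z) (im z)) ,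
            (λ z → solve 2 (λ a b → a :* :1 :- b :* con 𝟘 := a) ℝ.refl (re z) (im z) ,
                   solve 2 (λ a b → a :* con 𝟘 :+ b :* :1 := b) ℝ.refl (re z) (im z))
        ; distrib =
            (λ z w v →
              solve 6 (λ a b c d e f → a :* (c :+ e) :- b :* (d :+ f)
                                    := (a :* c :- b :* d) :+ (a :* e :- b :* f))
                ℝ.refl (re z) (im z) (re w) (im w) (re v) (im v) ,
              solve 6 (λ a b c d e f → a :* (d :+ f) :+ b :* (c :+ e)
                                    := (a :* d :+ b :* c) :+ (a :* f :+ b :* e))
                ℝ.refl (re z) (im z) (re w) (im w) (re v) (im v)) ,
            (λ z w v →
              solve 6 (λ a b c d e f → (c :+ e) :* a :- (d :+ f) :* b
                                    := (c :* a :- d :* b) :+ (e :* a :- f :* b))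
                ℝ.refl (re z) (im z) (re w) (im w) (re v) (im v) ,
              solve 6 (λ a b c d e f → (c :+ e) :* b :+ (d :+ f) :* a
                                    := (c :* b :+ d :* a) :+ (e :* b :+ f :* a))
                ℝ.refl (re z) (im z) (re w) (im w) (re v) (im v))
        }
      ; *-comm = λ z w →
          solve 4 (λ a b c d → a :* c :- b :* d := c :* a :- d :* b)
            ℝ.refl (re z) (im z) (re w) (im w) ,
          solve 4 (λ a b c d → a :* d :+ b :* c := c :* b :+ d :* a)
            ℝ.refl (re z) (im z) (re w) (im w)
      }
    }

  module ℂᴿ = CommutativeRing complexRing
  open SetoidReasoning ℂᴿ.setoid

  normSq : ℂ → ℝ.Carrier
  normSq z = re z ℝ.* re z ℝ.+ im z ℝ.* im z

  normSq-cong : ∀ {z w} → z ≈ w → normSq z ℝ.≈ normSq w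
  normSq-cong (p , q) = ℝ.+-cong (ℝ.*-cong p p) (ℝ.*-cong q q)

  normSq-nonneg : ∀ z → ℝ.0# ℝ.≤ normSq z
  normSq-nonneg z = ℝ.+-nonneg (ℝ.square-nonneg (re z)) (ℝ.square-nonneg (im z))

  normSq-* : ∀ z w → normSq (z * w) ℝ.≈ normSq z ℝ.* normSq w
  normSq-* z w = solve 4 (λ a b c d →
      (a :* c :- b :* d) :* (a :* c :- b :* d) :+ (a :* d :+ b :* c) :* (a :* d :+ b :* c)
      := (a :* a :+ b :* b) :* (c :* c :+ d :* d)) ℝ.refl (re z) (im z) (re w) (im w)

  normSq-1 : normSq 1# ℝ.≈ ℝ.1#
  normSq-1 = solve 0 (:1 :* :1 :+ con 𝟘 :* con 𝟘 := :1) ℝ.refl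

  normSq-^ : ∀ z n → normSq (z ^ n) ℝ.≈ normSq z ℝ.^ n
  normSq-^ z zero    = normSq-1
  normSq-^ z (suc n) = ℝ.trans (normSq-* z (z ^ n)) (ℝ.*-congˡ (normSq-^ z n))

  ∣z∣²≈normSq : ∀ z → ∣ z ∣ ℝ.^ 2 ℝ.≈ normSq z
  ∣z∣²≈normSq z = ℝ.trans (ℝ.*-congˡ (ℝ.*-identityʳ _)) (proj₂ (proj₂ (ℝ.sqrt (normSq-nonneg z))))

  conj : ℂ → ℂ
  conj z = re z +i (ℝ.- im z)

  conj-* : ∀ z w → conj (z * w) ≈ conj z * conj w
  conj-* z w =
    solve 4 (λ a b c d → a :* c :- b :* d := a :* c :- :- b :* :- d)
      ℝ.refl (re z) (im z) (re w) (im w) ,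
    solve 4 (λ a b c d → :- (a :* d :+ b :* c) := a :* :- d :+ :- b :* c)
      ℝ.refl (re z) (im z) (re w) (im w)

  conj-1 : conj 1# ≈ 1#
  conj-1 = ℝ.refl , solve 0 (:- con 𝟘 := con 𝟘) ℝ.refl

  conj-^ : ∀ z n → conj (z ^ n) ≈ conj z ^ n
  conj-^ z zero    = conj-1
  conj-^ z (suc n) = ℂᴿ.trans (conj-* z (z ^ n)) (ℂᴿ.*-congˡ (conj-^ z n))

  conj-∑ : ∀ {n} (f : Fin n → ℂ) → conj (∑ f) ≈ ∑ (λ i → conj (f i))
  conj-∑ {zero}  f = ℝ.refl , solve 0 (:- con 𝟘 := con 𝟘) ℝ.refl
  conj-∑ {suc n} f = ℂᴿ.trans
    (ℝ.refl , solve 2 (λ a b → :- (a :+ b) := :- a :+ :- b) ℝ.refl (im (f Fin.zero)) _)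
    (ℂᴿ.+-congˡ (conj-∑ (λ i → f (Fin.suc i))))

  z*conj : ∀ z → z * conj z ≈ normSq z +i ℝ.0#
  z*conj z =
    solve 2 (λ a b → a :* a :- b :* :- b := a :* a :+ b :* b) ℝ.refl (re z) (im z) ,
    solve 2 (λ a b → a :* :- b :+ b :* a := con 𝟘) ℝ.refl (re z) (im z)

  re-∑ : ∀ {n} (f : Fin n → ℂ) → re (∑ f) ≡ ℝ.∑ (λ i → re (f i))
  re-∑ {zero}  f = ≡.refl
  re-∑ {suc n} f = ≡.cong (re (f Fin.zero) ℝ.+_) (re-∑ (λ i → f (Fin.suc i)))

  _≟_ : Decidable _≈_
  z ≟ w with re z ℝ.≟ re w | im z ℝ.≟ im w
  ... | yes p | yes q = yes (p , q)
  ... | no ¬p | _     = no λ z≈w → ¬p (re-≈ z≈w)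
  ... | yes _ | no ¬q = no λ z≈w → ¬q (im-≈ z≈w)

  private
    square≉0⇒pos : ∀ {x} → ¬ (x ℝ.≈ ℝ.0#) → ℝ.0# ℝ.< x ℝ.* x
    square≉0⇒pos {x} x≉0 with ℝ.square-nonneg x
    ... | inj₁ 0<x² = 0<x²
    ... | inj₂ 0≈x² = ⊥-elim (x≉0 (ℝ.*-cancelˡ-≈0 x≉0 (ℝ.sym 0≈x²)))

  normSq-pos : ∀ {z} → ¬ (z ≈ 0#) → ℝ.0# ℝ.< normSq z
  normSq-pos {z} z≉0 with re z ℝ.≟ ℝ.0# | im z ℝ.≟ ℝ.0#
  ... | no re≉0 | _        = ℝ.+-pos-nonneg (square≉0⇒pos re≉0) (ℝ.square-nonneg (im z))
  ... | yes _   | no im≉0  = ℝ.<-≤-trans (ℝ.+-pos-nonneg (square≉0⇒pos im≉0) (ℝ.square-nonneg (re z)))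
                               (inj₂ (ℝ.+-comm _ _))
  ... | yes re≈0 | yes im≈0 = ⊥-elim (z≉0 (re≈0 , im≈0))

  ⁻¹-inverseˡ : ∀ {z} → ¬ (z ≈ 0#) → z ⁻¹ * z ≈ 1#
  ⁻¹-inverseˡ {z} z≉0 =
    ℝ.trans
      (solve 3 (λ n a b → (n :* a) :* a :- (n :* :- b) :* b := (a :* a :+ b :* b) :* n)
        ℝ.refl (normSq z ℝ.⁻¹) (re z) (im z))
      (ℝ.*-inverseʳ (ℝ.pos⇒≉0 (normSq-pos z≉0))) ,
    solve 3 (λ n a b → (n :* a) :* b :+ (n :* :- b) :* a := con 𝟘)
      ℝ.refl (normSq z ℝ.⁻¹) (re z) (im z)

  complexField : DiscreteField c ℓ₁
  complexField = record
    { commutativeRing = complexRing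
    ; _≟_ = _≟_
    ; inverse = λ {z} z≉0 → z ⁻¹ , ⁻¹-inverseˡ z≉0
    }

  open RootsOfUnity complexField public
  open Mult ℂᴿ.semiring using () renaming (_×_ to _·ℕ_)
  open Exp ℂᴿ.commutativeSemiring using (^-congˡ; ^-congʳ; ^-homo-*; ^-assocʳ; ^-distrib-*)
  open DifferenceSolver complexRing using () renaming
    (solve to solveℂ; _:=_ to _⊜_; _:+_ to _⊕_; _:*_ to _⊗_; _:-_ to _⊝_; :-_ to ⊟_; con to conℂ)

  1≉0 : ¬ (1# ≈ 0#)
  1≉0 1≈0 = ℝ.pos⇒≉0 ℝ.0<1 (re-≈ 1≈0)

  re-· : ∀ n z → re (n ·ℕ z) ≡ n ℝ.·ℕ re z
  re-· zero    z = ≡.refl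
  re-· (suc n) z = ≡.cong (re z ℝ.+_) (re-· n z)

  characteristic-0 : ∀ n .{{_ : NonZero n}} → ¬ (n ·ℕ 1# ≈ 0#)
  characteristic-0 n n≈0 = ℝ.pos⇒≉0 (ℝ.fromℕ-pos n)
    (≡.subst (ℝ._≈ ℝ.0#) (re-· n 1#) (re-≈ n≈0))

  root≉0 : ∀ {z} n .{{_ : NonZero n}} → z ^ n ≈ 1# → ¬ (z ≈ 0#)
  root≉0 {z} (suc n) z^n≈1 z≈0 = 1≉0 (begin
    1#          ≈⟨ z^n≈1 ⟨
    z * z ^ n   ≈⟨ ℂᴿ.*-congʳ z≈0 ⟩
    0# * z ^ n  ≈⟨ ℂᴿ.zeroˡ _ ⟩
    0#          ∎)

  -- The squared modulus is a nonnegative real whose n-th power is 1. Were it not 1, its geometric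
  -- sum would vanish, yet that sum is 1 plus nonnegative terms.
  normSq-root : ∀ {z} n .{{_ : NonZero n}} → z ^ n ≈ 1# → normSq z ℝ.≈ ℝ.1#
  normSq-root {z} (suc n) z^n≈1 with normSq z ℝ.≟ ℝ.1#
  ... | yes N≈1 = N≈1
  ... | no  N≉1 = ⊥-elim (ℝ.pos⇒≉0 (ℝ.+-pos-nonneg ℝ.0<1 (∑-nonneg (λ (i : Fin n) → ^-nonneg (suc (toℕ i)))))
          (ℝ.geometric-sum (suc n)
            (ℝ.trans (ℝ.sym (normSq-^ z (suc n))) (ℝ.trans (normSq-cong z^n≈1) normSq-1)) N≉1))
    where
    ^-nonneg : ∀ k → ℝ.0# ℝ.≤ normSq z ℝ.^ k
    ^-nonneg zero    = ℝ.0≤1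
    ^-nonneg (suc k) = ℝ.*-nonneg (normSq-nonneg z) (^-nonneg k)
    ∑-nonneg : ∀ {k} {f : Fin k → ℝ.Carrier} → (∀ i → ℝ.0# ℝ.≤ f i) → ℝ.0# ℝ.≤ ℝ.∑ f
    ∑-nonneg {zero}  0≤f = inj₂ ℝ.refl
    ∑-nonneg {suc k} 0≤f = ℝ.+-nonneg (0≤f Fin.zero) (∑-nonneg (λ i → 0≤f (Fin.suc i)))

  z*conj-root : ∀ {z} n .{{_ : NonZero n}} → z ^ n ≈ 1# → z * conj z ≈ 1#
  z*conj-root {z} n z^n≈1 = ℂᴿ.trans (z*conj z) (normSq-root n z^n≈1 , ℝ.refl)

  -- Primitive roots of unity in ℂ.

  -- z is exp (i π / (m + 2)), a primitive root of order 2 (m + 2).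
  module _ (m : ℕ) where
    open ℝ.LargestRoot (ℝ.largestRoot m)

    private
      n = suc (suc m)

      0<1-r² : ℝ.0# ℝ.< ℝ.1# ℝ.- r ℝ.* r
      0<1-r² = ℝ.<-≤-trans (ℝ.+-pos-nonneg (ℝ.<⇒0<- r<1) (ℝ.*-nonneg 0≤r (ℝ.≤⇒0≤- (inj₁ r<1))))
        (inj₂ (solve 1 (λ r → (:1 :- r) :+ r :* (:1 :- r) := :1 :- r :* r) ℝ.refl r))

      y : ℝ.Carrier
      y = proj₁ (ℝ.sqrt (inj₁ 0<1-r²))

      y²≈1-r² : y ℝ.* y ℝ.≈ ℝ.1# ℝ.- r ℝ.* r
      y²≈1-r² = proj₂ (proj₂ (ℝ.sqrt (inj₁ 0<1-r²)))

      0<y : ℝ.0# ℝ.< y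
      0<y = positive (proj₁ (proj₂ (ℝ.sqrt (inj₁ 0<1-r²))))
        where
        positive : ℝ.0# ℝ.≤ y → ℝ.0# ℝ.< y
        positive (inj₁ 0<y) = 0<y
        positive (inj₂ 0≈y) = ⊥-elim (ℝ.pos⇒≉0 0<1-r² (ℝ.trans (ℝ.sym y²≈1-r²)
          (ℝ.trans (ℝ.*-congʳ (ℝ.sym 0≈y)) (ℝ.zeroˡ y))))

      z : ℂ
      z = r +i y

      -- De Moivre's formula for θ with cos θ = r and sin θ = y: the real part is cos ((k+1)θ), the
      -- imaginary part sin ((k+1)θ).
      z^ : ∀ k → z ^ suc k ≈ (r ℝ.* ℝ.V (suc k) r ℝ.- ℝ.V k r) +i (y ℝ.* ℝ.V (suc k) r)
      z^ zero    = solve 2 (λ r y → r :* :1 :- y :* con 𝟘 := r :* :1 :- con 𝟘) ℝ.refl r y ,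
                   solve 2 (λ r y → r :* con 𝟘 :+ y :* :1 := y :* :1) ℝ.refl r y
      z^ (suc k) = ℂᴿ.trans (ℂᴿ.*-congˡ {z} (z^ k))
        (ℝ.trans
          (solve 4 (λ r y u v → r :* (r :* v :- u) :- y :* (y :* v)
                             := r :* (r :* v :- u) :- (y :* y) :* v) ℝ.refl r y (ℝ.V k r) (ℝ.V (suc k) r))
          (ℝ.trans (ℝ.+-congˡ (ℝ.-‿cong (ℝ.*-congʳ y²≈1-r²)))
            (solve 3 (λ r u v → r :* (r :* v :- u) :- (:1 :- r :* r) :* v
                             := r :* ((r :* v :+ r :* v) :- u) :- v) ℝ.refl r (ℝ.V k r) (ℝ.V (suc k) r))) ,
         solve 4 (λ r y u v → r :* (y :* v) :+ y :* (r :* v :- u)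
                           := y :* ((r :* v :+ r :* v) :- u)) ℝ.refl r y (ℝ.V k r) (ℝ.V (suc k) r))

      -- The counterpart of sin (π - π / n) = sin (π / n). Since `V n` vanishes at `r`, Cassini's
      -- identity makes the square 1, and positivity at `r` selects the sign.
      V≈1 : ℝ.V (suc m) r ℝ.≈ ℝ.1#
      V≈1 = ℝ.trans (solve 1 (λ v → v := (v :- :1) :+ :1) ℝ.refl v)
              (ℝ.trans (ℝ.+-congʳ v-1≈0) (ℝ.+-identityˡ ℝ.1#))
        where
        v = ℝ.V (suc m) r
        v²≈1 : v ℝ.* v ℝ.- ℝ.1# ℝ.≈ ℝ.0#
        v²≈1 = ℝ.trans
          (ℝ.+-congʳ (ℝ.trans
            (solve 2 (λ v u → v :* v := v :* v :- u :* con 𝟘) ℝ.refl v (ℝ.V m r))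
            (ℝ.trans (ℝ.+-congˡ (ℝ.-‿cong (ℝ.*-congˡ (ℝ.sym zero-at)))) (ℝ.V-cassini m r))))
          (ℝ.-‿inverseʳ ℝ.1#)
        v-1≈0 : v ℝ.- ℝ.1# ℝ.≈ ℝ.0#
        v-1≈0 = ℝ.*-cancelˡ-≈0 {v ℝ.+ ℝ.1#}
          (ℝ.pos⇒≉0 (ℝ.+-pos-nonneg (pos-at ℕ.≤-refl) ℝ.0≤1))
          (ℝ.trans (solve 1 (λ v → (v :+ :1) :* (v :- :1) := v :* v :- :1) ℝ.refl v) v²≈1)

      z^n≈-1 : z ^ n ≈ - 1#
      z^n≈-1 = ℂᴿ.trans (z^ (suc m))
        ( ℝ.trans (ℝ.+-cong (ℝ.*-congˡ zero-at) (ℝ.-‿cong V≈1))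
            (solve 1 (λ r → r :* con 𝟘 :- :1 := :- :1) ℝ.refl r)
        , ℝ.trans (ℝ.*-congˡ zero-at) (solve 1 (λ y → y :* con 𝟘 := :- con 𝟘) ℝ.refl y))

      -- In a field the only square roots of 1 are 1 and -1, both real.
      square≈1⇒real : ∀ {w} → w * w ≈ 1# → im w ℝ.≈ ℝ.0#
      square≈1⇒real {w} w²≈1 with w ≟ 1#
      ... | yes w≈1 = im-≈ w≈1
      ... | no  w≉1 = ℝ.trans (solve 1 (λ b → b := b :+ con 𝟘) ℝ.refl (im w)) (im-≈ w+1≈0)
        where
        w+1≈0 : w + 1# ≈ 0#
        w+1≈0 = *-cancelˡ-≈0 {w + - 1#}
          (λ w-1≈0 → w≉1 (begin
            w                ≈⟨ solveℂ 1 (λ w → w ⊜ (w ⊝ conℂ 𝟙) ⊕ conℂ 𝟙) ℂᴿ.refl w ⟩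
            w + - 1# + 1#    ≈⟨ ℂᴿ.+-congʳ w-1≈0 ⟩
            0# + 1#          ≈⟨ ℂᴿ.+-identityˡ 1# ⟩
            1#               ∎))
          (begin
            (w + - 1#) * (w + 1#)  ≈⟨ solveℂ 1 (λ w → (w ⊝ conℂ 𝟙) ⊗ (w ⊕ conℂ 𝟙) ⊜ w ⊗ w ⊝ conℂ 𝟙) ℂᴿ.refl w ⟩
            w * w + - 1#           ≈⟨ ℂᴿ.+-congʳ w²≈1 ⟩
            1# + - 1#              ≈⟨ ℂᴿ.-‿inverseʳ 1# ⟩
            0#                     ∎)

    primitive-square : ∃ (Primitive n)
    primitive-square = z * z , record
      { ^-order = begin
          (z * z) ^ n    ≈⟨ ^-distrib-* z z n ⟩
          z ^ n * z ^ n  ≈⟨ ℂᴿ.*-cong z^n≈-1 z^n≈-1 ⟩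
          - 1# * - 1#    ≈⟨ solveℂ 0 (⊟ conℂ 𝟙 ⊗ ⊟ conℂ 𝟙 ⊜ conℂ 𝟙) ℂᴿ.refl ⟩
          1#             ∎
      -- The exponents `suc k` below `n` are exactly those with `k ≤ m`, the range of `pos-at`.
      -- There the imaginary part of `z ^ suc k` is positive, so its square cannot be 1.
      ; minimal = λ { {suc k} _ (s≤s (s≤s k≤m)) [z²]^k≈1 →
          ℝ.pos⇒≉0 (ℝ.*-pos 0<y (pos-at k≤m))
            (ℝ.trans (ℝ.sym (im-≈ (z^ k)))
              (square≈1⇒real (ℂᴿ.trans (ℂᴿ.sym (^-distrib-* z z (suc k))) [z²]^k≈1))) }
      }

  primitive-root : ∀ n .{{_ : NonZero n}} → ∃ (Primitive n)
  primitive-root 1 = 1# , record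
    { ^-order = ^-zeroˡ 1
    ; minimal = λ { (s≤s _) (s≤s ()) }
    }
  primitive-root (suc (suc m)) = primitive-square m

  -- Counting 𝒵 by the Chinese remainder theorem.

  open Sum ℂᴿ.semiring using
    (sum-cong-≋; sum-replicate; sum-replicate-zero; ∑-comm; sum-remove; *-distribˡ-sum; *-distribʳ-sum)
  open Finite

  private
    same-size-≤ : ∀ {ℓ} {P : ℂ → Set ℓ} (Z Z′ : Finite P) → size Z ℕ.≤ size Z′
    same-size-≤ Z Z′ = Fin.injective⇒≤ {f = λ i → proj₁ (complete Z′ (sound Z i))} λ {i} {j} eq →
      injective Z (ℂᴿ.trans (ℂᴿ.sym (proj₂ (complete Z′ (sound Z i))))
        (≡.subst (λ k → enum Z′ k ≈ enum Z j) (≡.sym eq) (proj₂ (complete Z′ (sound Z j)))))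

  -- Sending an index to the index of the same number in the other enumeration is injective, in both
  -- directions. This transfers the count from one explicit enumeration to an arbitrary one.
  size-unique : ∀ {ℓ} {P : ℂ → Set ℓ} (Z Z′ : Finite P) → size Z ≡ size Z′
  size-unique Z Z′ = ℕ.≤-antisym (same-size-≤ Z Z′) (same-size-≤ Z′ Z)

  module Enumeration (p-1 q-1 : ℕ) (coprime : Coprime (suc p-1) (suc q-1)) where

    private
      p = suc p-1
      q = suc q-1
      exponents = crt-exponents coprime
      e  = proj₁ exponents
      e′ = proj₁ (proj₂ exponents)
      q∣e : q ∣ e
      q∣e = proj₁ (proj₂ (proj₂ exponents))
      p∣e′ : p ∣ e′
      p∣e′ = proj₁ (proj₂ (proj₂ (proj₂ exponents)))
      k = proj₁ (proj₂ (proj₂ (proj₂ (proj₂ exponents))))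
      e+e′≡1 : e ℕ.+ e′ ≡ 1 ℕ.+ k ℕ.* (p ℕ.* q)
      e+e′≡1 = proj₂ (proj₂ (proj₂ (proj₂ (proj₂ exponents))))
      α = proj₁ (primitive-root p)
      β = proj₁ (primitive-root q)
      α-primitive : Primitive p α
      α-primitive = proj₂ (primitive-root p)
      β-primitive : Primitive q β
      β-primitive = proj₂ (primitive-root q)
      module α = Primitive α-primitive
      module β = Primitive β-primitive

      p∣pq : p ∣ p ℕ.* q
      p∣pq = divides q (ℕ.*-comm p q)
      q∣pq : q ∣ p ℕ.* q
      q∣pq = divides p ≡.refl

      recombine : ∀ {z} → z ^ (p ℕ.* q) ≈ 1# → z ^ e * z ^ e′ ≈ z
      recombine {z} z^pq≈1 = begin
        z ^ e * z ^ e′               ≈⟨ ^-homo-* z e e′ ⟨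
        z ^ (e ℕ.+ e′)               ≈⟨ ^-congʳ z e+e′≡1 ⟩
        z * z ^ (k ℕ.* (p ℕ.* q))    ≈⟨ ℂᴿ.*-congˡ (^≈1⇒^∣≈1 (divides k ≡.refl) z^pq≈1) ⟩
        z * 1#                       ≈⟨ ℂᴿ.*-identityʳ z ⟩
        z                            ∎

      p-part : ∀ {z} → z ^ p ≈ 1# → z ^ e ≈ z
      p-part {z} z^p≈1 = begin
        z ^ e            ≈⟨ ℂᴿ.*-identityʳ _ ⟨
        z ^ e * 1#       ≈⟨ ℂᴿ.*-congˡ (^≈1⇒^∣≈1 p∣e′ z^p≈1) ⟨
        z ^ e * z ^ e′   ≈⟨ recombine (^≈1⇒^∣≈1 p∣pq z^p≈1) ⟩
        z                ∎

      q-part : ∀ {z} → z ^ q ≈ 1# → z ^ e′ ≈ z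
      q-part {z} z^q≈1 = begin
        z ^ e′           ≈⟨ ℂᴿ.*-identityˡ _ ⟨
        1# * z ^ e′      ≈⟨ ℂᴿ.*-congʳ (^≈1⇒^∣≈1 q∣e z^q≈1) ⟨
        z ^ e * z ^ e′   ≈⟨ recombine (^≈1⇒^∣≈1 q∣pq z^q≈1) ⟩
        z                ∎

      element : ℕ → ℕ → ℂ
      element a b = α ^ a * β ^ b

      element^pq : ∀ a b → element a b ^ (p ℕ.* q) ≈ 1#
      element^pq a b = begin
        (α ^ a * β ^ b) ^ (p ℕ.* q)                ≈⟨ ^-distrib-* (α ^ a) (β ^ b) (p ℕ.* q) ⟩
        (α ^ a) ^ (p ℕ.* q) * (β ^ b) ^ (p ℕ.* q)
          ≈⟨ ℂᴿ.*-cong (^≈1⇒^^≈1 a (p ℕ.* q) (^≈1⇒^∣≈1 p∣pq α.^-order))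
                       (^≈1⇒^^≈1 b (p ℕ.* q) (^≈1⇒^∣≈1 q∣pq β.^-order)) ⟩
        1# * 1#                                    ≈⟨ ℂᴿ.*-identityˡ 1# ⟩
        1#                                         ∎

      -- The exponent `e` fixes p-th roots of unity and kills q-th ones, so it reads off the first
      -- coordinate; `e′` does the same for the second. Injectivity and membership in 𝒵 both rest on
      -- this.
      element^e : ∀ a b → element a b ^ e ≈ α ^ a
      element^e a b = begin
        (α ^ a * β ^ b) ^ e        ≈⟨ ^-distrib-* (α ^ a) (β ^ b) e ⟩
        (α ^ a) ^ e * (β ^ b) ^ e
          ≈⟨ ℂᴿ.*-cong (p-part (^≈1⇒^^≈1 a p α.^-order)) (^≈1⇒^∣≈1 q∣e (^≈1⇒^^≈1 b q β.^-order)) ⟩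
        α ^ a * 1#                 ≈⟨ ℂᴿ.*-identityʳ _ ⟩
        α ^ a                      ∎

      element^e′ : ∀ a b → element a b ^ e′ ≈ β ^ b
      element^e′ a b = begin
        (α ^ a * β ^ b) ^ e′         ≈⟨ ^-distrib-* (α ^ a) (β ^ b) e′ ⟩
        (α ^ a) ^ e′ * (β ^ b) ^ e′
          ≈⟨ ℂᴿ.*-cong (^≈1⇒^∣≈1 p∣e′ (^≈1⇒^^≈1 a p α.^-order)) (q-part (^≈1⇒^^≈1 b q β.^-order)) ⟩
        1# * β ^ b                   ≈⟨ ℂᴿ.*-identityˡ _ ⟩
        β ^ b                        ∎

      element-injective : ∀ {a b a′ b′} → a ℕ.< p → b ℕ.< q → a′ ℕ.< p → b′ ℕ.< q →
                          element a b ≈ element a′ b′ → a ≡ a′ × b ≡ b′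
      element-injective {a} {b} {a′} {b′} a<p b<q a′<p b′<q eq =
        ^-injective α-primitive a<p a′<p
          (ℂᴿ.trans (ℂᴿ.sym (element^e a b)) (ℂᴿ.trans (^-congˡ e eq) (element^e a′ b′))) ,
        ^-injective β-primitive b<q b′<q
          (ℂᴿ.trans (ℂᴿ.sym (element^e′ a b)) (ℂᴿ.trans (^-congˡ e′ eq) (element^e′ a′ b′)))

      -- As `p` divides `e′`, a trivial p-th power would make the second coordinate `β ^ suc b`
      -- trivial; likewise with `q`, `e` and the first coordinate.
      element∈𝒵 : ∀ {a b} → suc a ℕ.< p → suc b ℕ.< q → 𝒵 p q (element (suc a) (suc b))
      element∈𝒵 {a} {b} 1+a<p 1+b<q = element^pq (suc a) (suc b) ,
        (λ ζ^p≈1 → β.minimal (s≤s z≤n) 1+b<q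
          (ℂᴿ.trans (ℂᴿ.sym (element^e′ (suc a) (suc b))) (^≈1⇒^∣≈1 p∣e′ ζ^p≈1))) ,
        (λ ζ^q≈1 → α.minimal (s≤s z≤n) 1+a<p
          (ℂᴿ.trans (ℂᴿ.sym (element^e (suc a) (suc b))) (^≈1⇒^∣≈1 q∣e ζ^q≈1)))

      𝒵⇒element : ∀ {z} → 𝒵 p q z →
                  ∃₂ λ a b → suc a ℕ.< p × suc b ℕ.< q × element (suc a) (suc b) ≈ z
      𝒵⇒element {z} (z^pq≈1 , z^p≉1 , z^q≉1) =
        combine (root⇒power (characteristic-0 p) α-primitive z^e^p≈1)
                (root⇒power (characteristic-0 q) β-primitive z^e′^q≈1)
        where
        z^e^p≈1 : (z ^ e) ^ p ≈ 1#
        z^e^p≈1 = ℂᴿ.trans (^-assocʳ z e p) (^≈1⇒^∣≈1 pq∣ep z^pq≈1)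
          where
          pq∣ep : p ℕ.* q ∣ e ℕ.* p
          pq∣ep = ≡.subst (_∣ e ℕ.* p) (ℕ.*-comm q p) (*-monoˡ-∣ p q∣e)
        z^e′^q≈1 : (z ^ e′) ^ q ≈ 1#
        z^e′^q≈1 = ℂᴿ.trans (^-assocʳ z e′ q) (^≈1⇒^∣≈1 (*-monoˡ-∣ q p∣e′) z^pq≈1)
        z≈z^e*z^e′ : z ≈ z ^ e * z ^ e′
        z≈z^e*z^e′ = ℂᴿ.sym (recombine z^pq≈1)
        combine : (∃ λ a → a ℕ.< p × z ^ e ≈ α ^ a) → (∃ λ b → b ℕ.< q × z ^ e′ ≈ β ^ b) →
                  ∃₂ λ a b → suc a ℕ.< p × suc b ℕ.< q × element (suc a) (suc b) ≈ z
        -- With a trivial p-part, z equals its q-part and so is a q-th root of unity, which 𝒵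
        -- excludes; the next case is symmetric.
        combine (zero , _ , z^e≈1) _ = ⊥-elim (z^q≉1 (begin
          z ^ q          ≈⟨ ^-congˡ q (ℂᴿ.trans z≈z^e*z^e′ (ℂᴿ.trans (ℂᴿ.*-congʳ z^e≈1) (ℂᴿ.*-identityˡ _))) ⟩
          (z ^ e′) ^ q   ≈⟨ z^e′^q≈1 ⟩
          1#             ∎))
        combine (suc _ , _ , _) (zero , _ , z^e′≈1) = ⊥-elim (z^p≉1 (begin
          z ^ p          ≈⟨ ^-congˡ p (ℂᴿ.trans z≈z^e*z^e′ (ℂᴿ.trans (ℂᴿ.*-congˡ z^e′≈1) (ℂᴿ.*-identityʳ _))) ⟩
          (z ^ e) ^ p    ≈⟨ z^e^p≈1 ⟩
          1#             ∎))
        combine (suc a , a<p , z^e≈) (suc b , b<q , z^e′≈) = a , b , a<p , b<q , (begin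
          element (suc a) (suc b)  ≈⟨ ℂᴿ.*-cong z^e≈ z^e′≈ ⟨
          z ^ e * z ^ e′           ≈⟨ z≈z^e*z^e′ ⟨
          z                        ∎)

    finite-𝒵 : Finite (𝒵 p q)
    finite-𝒵 = record
      { size = p-1 ℕ.* q-1
      ; enum = λ i → f (split i)
      ; injective = λ {i} {j} eq → ≡.trans (≡.sym (Fin.combine-remQuot {p-1} q-1 i))
          (≡.trans (≡.cong (λ (a , b) → Fin.combine a b) (f-injective (split i) (split j) eq))
            (Fin.combine-remQuot {p-1} q-1 j))
      ; sound = λ i → element∈𝒵 (s≤s (Fin.toℕ<n (proj₁ (split i)))) (s≤s (Fin.toℕ<n (proj₂ (split i))))
      ; complete = λ z∈𝒵 → index (𝒵⇒element z∈𝒵)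
      }
      where
      split : Fin (p-1 ℕ.* q-1) → Fin p-1 × Fin q-1
      split = Fin.remQuot q-1
      f : Fin p-1 × Fin q-1 → ℂ
      -- The shift by one omits the exponent 0 in both factors, that is, the trivial p-part and the
      -- trivial q-part.
      f (a , b) = element (suc (toℕ a)) (suc (toℕ b))
      f-injective : ∀ s t → f s ≈ f t → s ≡ t
      f-injective (a , b) (a′ , b′) eq =
        let a≡a′ , b≡b′ = element-injective (s≤s (Fin.toℕ<n a)) (s≤s (Fin.toℕ<n b))
                            (s≤s (Fin.toℕ<n a′)) (s≤s (Fin.toℕ<n b′)) eq
        in ≡.cong₂ _,_ (Fin.toℕ-injective (ℕ.suc-injective a≡a′)) (Fin.toℕ-injective (ℕ.suc-injective b≡b′))
      index : ∀ {z} → (∃₂ λ a b → suc a ℕ.< p × suc b ℕ.< q × element (suc a) (suc b) ≈ z) →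
              ∃ λ i → f (split i) ≈ z
      index (a , b , s≤s a<p-1 , s≤s b<q-1 , eq) =
        Fin.combine i j , ℂᴿ.trans (ℂᴿ.reflexive (≡.trans (≡.cong f (Fin.remQuot-combine i j))
          (≡.cong₂ (λ a b → element (suc a) (suc b)) (Fin.toℕ-fromℕ< a<p-1) (Fin.toℕ-fromℕ< b<q-1)))) eq
        where
        i = Fin.fromℕ< a<p-1
        j = Fin.fromℕ< b<q-1

  -- Integer powers and periodicity.

  ^ᶻ-⊖ : ∀ {z} → ¬ (z ≈ 0#) → ∀ m n → z ^ᶻ (m ℤ.⊖ n) * z ^ n ≈ z ^ m
  ^ᶻ-⊖ z≉0 m zero = ℂᴿ.*-identityʳ _
  ^ᶻ-⊖ {z} z≉0 zero (suc n) = begin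
    (z ⁻¹) ^ suc n * z ^ suc n  ≈⟨ ^-distrib-* (z ⁻¹) z (suc n) ⟨
    (z ⁻¹ * z) ^ suc n          ≈⟨ ^-congˡ (suc n) (⁻¹-inverseˡ z≉0) ⟩
    1# ^ suc n                  ≈⟨ ^-zeroˡ (suc n) ⟩
    1#                          ∎
  ^ᶻ-⊖ {z} z≉0 (suc m) (suc n) = begin
    z ^ᶻ (suc m ℤ.⊖ suc n) * z ^ suc n
      ≈⟨ ℂᴿ.*-congʳ (ℂᴿ.reflexive (≡.cong (z ^ᶻ_) (ℤ.[1+m]⊖[1+n]≡m⊖n m n))) ⟩
    z ^ᶻ (m ℤ.⊖ n) * (z * z ^ n)   ≈⟨ ℂᴿ.*-assoc _ _ _ ⟨
    z ^ᶻ (m ℤ.⊖ n) * z * z ^ n     ≈⟨ ℂᴿ.*-congʳ (ℂᴿ.*-comm _ z) ⟩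
    z * z ^ᶻ (m ℤ.⊖ n) * z ^ n     ≈⟨ ℂᴿ.*-assoc _ _ _ ⟩
    z * (z ^ᶻ (m ℤ.⊖ n) * z ^ n)   ≈⟨ ℂᴿ.*-congˡ (^ᶻ-⊖ z≉0 m n) ⟩
    z * z ^ m                      ∎

  -- For a negative exponent the shifted one computes to `n ⊖ suc m`, which may have either sign.
  -- `^ᶻ-⊖` treats both signs at once, after the factor z^(-(m+1)) z^(m+1) = 1 has been inserted.
  ^ᶻ-periodic : ∀ {z} n .{{_ : NonZero n}} → z ^ n ≈ 1# → ∀ m → z ^ᶻ (m ℤ.+ + n) ≈ z ^ᶻ m
  ^ᶻ-periodic {z} n z^n≈1 (+ m) = begin
    z ^ (m ℕ.+ n)  ≈⟨ ^-homo-* z m n ⟩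
    z ^ m * z ^ n  ≈⟨ ℂᴿ.*-congˡ z^n≈1 ⟩
    z ^ m * 1#     ≈⟨ ℂᴿ.*-identityʳ _ ⟩
    z ^ m          ∎
  ^ᶻ-periodic {z} n z^n≈1 -[1+ m ] = begin
    z ^ᶻ (n ℤ.⊖ suc m)                                      ≈⟨ ℂᴿ.*-identityʳ _ ⟨
    z ^ᶻ (n ℤ.⊖ suc m) * 1#                                 ≈⟨ ℂᴿ.*-congˡ (^ᶻ-⊖ z≉0 0 (suc m)) ⟨
    z ^ᶻ (n ℤ.⊖ suc m) * ((z ⁻¹) ^ suc m * z ^ suc m)       ≈⟨ ℂᴿ.*-congˡ (ℂᴿ.*-comm _ _) ⟩
    z ^ᶻ (n ℤ.⊖ suc m) * (z ^ suc m * (z ⁻¹) ^ suc m)       ≈⟨ ℂᴿ.*-assoc _ _ _ ⟨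
    z ^ᶻ (n ℤ.⊖ suc m) * z ^ suc m * (z ⁻¹) ^ suc m         ≈⟨ ℂᴿ.*-congʳ (^ᶻ-⊖ z≉0 n (suc m)) ⟩
    z ^ n * (z ⁻¹) ^ suc m                                  ≈⟨ ℂᴿ.*-congʳ z^n≈1 ⟩
    1# * (z ⁻¹) ^ suc m                                     ≈⟨ ℂᴿ.*-identityˡ _ ⟩
    (z ⁻¹) ^ suc m                                          ∎
    where z≉0 = root≉0 n z^n≈1

  -- Mean and variance of power sums.

  ∑-single : ∀ {n} (f : Fin n → ℂ) i → (∀ j → j ≢ i → f j ≈ 0#) → ∑ f ≈ f i
  ∑-single {suc n} f i f≈0 = begin
    ∑ f                    ≈⟨ sum-remove {i = i} f ⟩
    f i + ∑ (removeAt f i) ≈⟨ ℂᴿ.+-congˡ (ℂᴿ.trans (sum-cong-≋ (λ j → f≈0 _ (Fin.punchInᵢ≢i i j)))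
                                               (sum-replicate-zero n)) ⟩
    f i + 0#               ≈⟨ ℂᴿ.+-identityʳ _ ⟩
    f i                    ∎

  module PowerSums (N : ℕ) .{{_ : NonZero N}} {n} (ζ : Fin n → ℂ)
    (ζ^N≈1 : ∀ i → ζ i ^ N ≈ 1#) where

    -- Natural exponents suffice: the averages run over `+ toℕ m`, where `_^ᶻ_` computes to `_^_`.
    S : ℕ → ℂ
    S m = ∑ (λ i → ζ i ^ m)

    mean : (∀ i → ¬ (ζ i ≈ 1#)) → ∑ (λ (m : Fin N) → S (toℕ m)) ≈ 0#
    mean ζ≉1 = begin
      ∑ (λ (m : Fin N) → ∑ (λ i → ζ i ^ toℕ m))  ≈⟨ ∑-comm (λ (m : Fin N) i → ζ i ^ toℕ m) ⟩
      ∑ (λ i → ∑ (λ (m : Fin N) → ζ i ^ toℕ m))  ≈⟨ sum-cong-≋ (λ i → geometric-sum N (ζ^N≈1 i) (ζ≉1 i)) ⟩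
      ∑ (λ (i : Fin n) → 0#)                     ≈⟨ sum-replicate-zero n ⟩
      0#                                         ∎

    -- Rewrites the squared modulus as a power sum over pairs, so that summing over `m` meets a
    -- geometric sum for each pair.
    S*conjS : ∀ m → S m * conj (S m) ≈ ∑ (λ i → ∑ (λ j → (ζ i * conj (ζ j)) ^ m))
    S*conjS m = begin
      S m * conj (S m)
        ≈⟨ ℂᴿ.*-congˡ (ℂᴿ.trans (conj-∑ (λ j → ζ j ^ m)) (sum-cong-≋ (λ j → conj-^ (ζ j) m))) ⟩
      S m * ∑ (λ j → conj (ζ j) ^ m)
        ≈⟨ *-distribʳ-sum (∑ (λ j → conj (ζ j) ^ m)) (λ i → ζ i ^ m) ⟩
      ∑ (λ i → ζ i ^ m * ∑ (λ j → conj (ζ j) ^ m))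
        ≈⟨ sum-cong-≋ (λ i → *-distribˡ-sum (ζ i ^ m) (λ j → conj (ζ j) ^ m)) ⟩
      ∑ (λ i → ∑ (λ j → ζ i ^ m * conj (ζ j) ^ m))
        ≈⟨ sum-cong-≋ (λ i → sum-cong-≋ (λ j → ^-distrib-* (ζ i) (conj (ζ j)) m)) ⟨
      ∑ (λ i → ∑ (λ j → (ζ i * conj (ζ j)) ^ m)) ∎

    module _ (ζ-injective : ∀ {i j} → ζ i ≈ ζ j → i ≡ j) where

      ratio : Fin n → Fin n → ℂ
      ratio i j = ζ i * conj (ζ j)

      ratio^N≈1 : ∀ i j → ratio i j ^ N ≈ 1#
      ratio^N≈1 i j = begin
        (ζ i * conj (ζ j)) ^ N      ≈⟨ ^-distrib-* (ζ i) (conj (ζ j)) N ⟩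
        ζ i ^ N * conj (ζ j) ^ N    ≈⟨ ℂᴿ.*-congʳ (ζ^N≈1 i) ⟩
        1# * conj (ζ j) ^ N         ≈⟨ ℂᴿ.*-congʳ (ζ^N≈1 j) ⟨
        ζ j ^ N * conj (ζ j) ^ N    ≈⟨ ^-distrib-* (ζ j) (conj (ζ j)) N ⟨
        (ζ j * conj (ζ j)) ^ N      ≈⟨ ^-congˡ N (z*conj-root N (ζ^N≈1 j)) ⟩
        1# ^ N                      ≈⟨ ^-zeroˡ N ⟩
        1#                          ∎

      -- On the unit circle conjugation is inversion, so `ratio i j` is the quotient of `ζ i` by
      -- `ζ j`.
      ratio≈1⇒≡ : ∀ {i j} → ratio i j ≈ 1# → i ≡ j
      ratio≈1⇒≡ {i} {j} ratio≈1 = ζ-injective (begin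
        ζ i                        ≈⟨ ℂᴿ.*-identityʳ _ ⟨
        ζ i * 1#                   ≈⟨ ℂᴿ.*-congˡ (z*conj-root N (ζ^N≈1 j)) ⟨
        ζ i * (ζ j * conj (ζ j))   ≈⟨ ℂᴿ.*-congˡ (ℂᴿ.*-comm _ _) ⟩
        ζ i * (conj (ζ j) * ζ j)   ≈⟨ ℂᴿ.*-assoc _ _ _ ⟨
        ratio i j * ζ j            ≈⟨ ℂᴿ.*-congʳ ratio≈1 ⟩
        1# * ζ j                   ≈⟨ ℂᴿ.*-identityˡ _ ⟩
        ζ j                        ∎)

      ratio-sum : ∀ i → ∑ (λ j → ∑ (λ (m : Fin N) → ratio i j ^ toℕ m)) ≈ N ·ℕ 1#
      ratio-sum i = begin
        ∑ (λ j → ∑ (λ (m : Fin N) → ratio i j ^ toℕ m))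
          ≈⟨ ∑-single (λ j → ∑ (λ (m : Fin N) → ratio i j ^ toℕ m)) i
               (λ j j≢i → geometric-sum N (ratio^N≈1 i j) (λ eq → j≢i (≡.sym (ratio≈1⇒≡ eq)))) ⟩
        ∑ (λ (m : Fin N) → ratio i i ^ toℕ m)
          ≈⟨ sum-cong-≋ (λ (m : Fin N) → ℂᴿ.trans
               (^-congˡ (toℕ m) (z*conj-root N (ζ^N≈1 i))) (^-zeroˡ (toℕ m))) ⟩
        ∑ (λ (m : Fin N) → 1#)
          ≈⟨ sum-replicate N ⟩
        N ·ℕ 1# ∎

      ∑-S*conjS : ∑ (λ (m : Fin N) → S (toℕ m) * conj (S (toℕ m))) ≈ n ·ℕ (N ·ℕ 1#)
      ∑-S*conjS = begin
        ∑ (λ (m : Fin N) → S (toℕ m) * conj (S (toℕ m)))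
          ≈⟨ sum-cong-≋ (λ (m : Fin N) → S*conjS (toℕ m)) ⟩
        ∑ (λ (m : Fin N) → ∑ (λ i → ∑ (λ j → ratio i j ^ toℕ m)))
          ≈⟨ ∑-comm (λ (m : Fin N) i → ∑ (λ j → ratio i j ^ toℕ m)) ⟩
        ∑ (λ i → ∑ (λ (m : Fin N) → ∑ (λ j → ratio i j ^ toℕ m)))
          ≈⟨ sum-cong-≋ (λ i → ∑-comm (λ (m : Fin N) j → ratio i j ^ toℕ m)) ⟩
        ∑ (λ i → ∑ (λ j → ∑ (λ (m : Fin N) → ratio i j ^ toℕ m)))
          ≈⟨ sum-cong-≋ ratio-sum ⟩
        ∑ (λ (i : Fin n) → N ·ℕ 1#)
          ≈⟨ sum-replicate n ⟩
        n ·ℕ (N ·ℕ 1#) ∎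

      -- The squared absolute values are real while `∑-S*conjS` is an identity in ℂ, so real parts
      -- are taken on both sides.
      variance : ℝ.∑ (λ (m : Fin N) → ∣ S (toℕ m) ∣ ℝ.^ 2) ℝ.≈ ℝ.fromℕ n ℝ.* ℝ.fromℕ N
      variance =
        ℝ.trans (ℝ.sum-cong-≋ (λ (m : Fin N) → ℝ.trans (∣z∣²≈normSq (S (toℕ m)))
                                                   (ℝ.sym (re-≈ (z*conj (S (toℕ m)))))))
        (≡.subst₂ ℝ._≈_ (re-∑ (λ (m : Fin N) → S (toℕ m) * conj (S (toℕ m)))) re-total
           (re-≈ ∑-S*conjS) ⟨ ℝ.trans ⟩ n·N)
        where
        re-total : re (n ·ℕ (N ·ℕ 1#)) ≡ n ℝ.·ℕ ℝ.fromℕ N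
        re-total = ≡.trans (re-· n (N ·ℕ 1#)) (≡.cong (n ℝ.·ℕ_) (re-· N 1#))
        n·N : n ℝ.·ℕ ℝ.fromℕ N ℝ.≈ ℝ.fromℕ n ℝ.* ℝ.fromℕ N
        n·N = ℝ.trans (ℝ.×-congʳ n (ℝ.sym (ℝ.*-identityˡ _))) (ℝ.sym (ℝ.×-assoc-* n ℝ.1# (ℝ.fromℕ N)))

-- The first component provides an enumeration of `𝒵 p q`, so the quantification over all of them in
-- the second is not vacuous.
proposition3p10 :
  ∀ {c ℓ₁ ℓ₂} (R : CompleteOrderedField c ℓ₁ ℓ₂) →
  let module ℝ = RealProperties R
      open Complex R
  in
  ∀ (p q : ℕ) .{{_ : NonZero p}} .{{_ : NonZero q}} → Coprime p q →
  Finite (𝒵 p q) ×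
  (∀ (Z : Finite (𝒵 p q)) →
    let S : ℤ → ℂ
        S = moment p q Z
    in
    (∀ (m : ℤ) → S (m ℤ.+ + (p ℕ.* q)) ≈ S m) ×
    (ℝ.fromℕ (p ℕ.* q) ℝ.⁻¹ · ∑ (λ (m : Fin (p ℕ.* q)) → S (+ toℕ m)) ≈ 0#) ×
    (ℝ.fromℕ (p ℕ.* q) ℝ.⁻¹ ℝ.* ℝ.∑ (λ (m : Fin (p ℕ.* q)) → ∣ S (+ toℕ m) ∣ ℝ.^ 2)
      ℝ.≈ (ℝ.fromℕ p ℝ.- ℝ.1#) ℝ.* (ℝ.fromℕ q ℝ.- ℝ.1#)))
proposition3p10 R p@(suc p-1) q@(suc q-1) coprime = finite-𝒵 , λ Z →
  periodic Z , mean≈0 Z , variance≈ Z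
  where
  open Complex R
  open ComplexField R
  open Enumeration p-1 q-1 coprime
  open Finite
  open Sum ℂᴿ.semiring using (sum-cong-≋)
  open Exp ℂᴿ.commutativeSemiring using (^-congˡ)
  open ℝ using (solve; _:=_; _:+_; _:*_; _:-_; :1)

  N : ℝ.Carrier
  N = ℝ.fromℕ (p ℕ.* q)

  periodic : ∀ Z m → moment p q Z (m ℤ.+ + (p ℕ.* q)) ≈ moment p q Z m
  periodic Z m = sum-cong-≋ (λ i → ^ᶻ-periodic (p ℕ.* q) (proj₁ (sound Z i)) m)

  mean≈0 : ∀ Z → N ℝ.⁻¹ · ∑ (λ (m : Fin (p ℕ.* q)) → moment p q Z (+ toℕ m)) ≈ 0#
  mean≈0 Z = ℝ.trans (ℝ.*-congˡ (re-≈ ∑≈0)) (ℝ.zeroʳ _) , ℝ.trans (ℝ.*-congˡ (im-≈ ∑≈0)) (ℝ.zeroʳ _)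
    where
    ∑≈0 = PowerSums.mean (p ℕ.* q) (enum Z) (proj₁ ∘ sound Z)
      (λ i ζ≈1 → proj₁ (proj₂ (sound Z i)) (ℂᴿ.trans (^-congˡ p ζ≈1) (^-zeroˡ p)))

  variance≈ : ∀ Z → N ℝ.⁻¹ ℝ.* ℝ.∑ (λ (m : Fin (p ℕ.* q)) → ∣ moment p q Z (+ toℕ m) ∣ ℝ.^ 2)
                    ℝ.≈ (ℝ.fromℕ p ℝ.- ℝ.1#) ℝ.* (ℝ.fromℕ q ℝ.- ℝ.1#)
  variance≈ Z = begin
    N ℝ.⁻¹ ℝ.* ℝ.∑ (λ (m : Fin (p ℕ.* q)) → ∣ moment p q Z (+ toℕ m) ∣ ℝ.^ 2)
      ≈⟨ ℝ.*-congˡ (PowerSums.variance (p ℕ.* q) (enum Z) (proj₁ ∘ sound Z) (injective Z)) ⟩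
    N ℝ.⁻¹ ℝ.* (ℝ.fromℕ (size Z) ℝ.* N)
      ≈⟨ solve 3 (λ i s N → i :* (s :* N) := (N :* i) :* s) ℝ.refl (N ℝ.⁻¹) (ℝ.fromℕ (size Z)) N ⟩
    N ℝ.* N ℝ.⁻¹ ℝ.* ℝ.fromℕ (size Z)
      ≈⟨ ℝ.*-congʳ (ℝ.*-inverseʳ (ℝ.pos⇒≉0 (ℝ.fromℕ-pos (p ℕ.* q)))) ⟩
    ℝ.1# ℝ.* ℝ.fromℕ (size Z)
      ≈⟨ ℝ.*-identityˡ _ ⟩
    ℝ.fromℕ (size Z)
      ≈⟨ ℝ.×-congˡ (size-unique Z finite-𝒵) ⟩
    ℝ.fromℕ (p-1 ℕ.* q-1)
      ≈⟨ ℝ.×1-homo-* p-1 q-1 ⟩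
    ℝ.fromℕ p-1 ℝ.* ℝ.fromℕ q-1
      ≈⟨ solve 2 (λ a b → a :* b := ((:1 :+ a) :- :1) :* ((:1 :+ b) :- :1)) ℝ.refl
           (ℝ.fromℕ p-1) (ℝ.fromℕ q-1) ⟩
    (ℝ.fromℕ p ℝ.- ℝ.1#) ℝ.* (ℝ.fromℕ q ℝ.- ℝ.1#) ∎
    where open SetoidReasoning ℝ.setoid
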